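{- Let $U$ be a tree topology and let $U'$ be any extension of $U$. If the polyhedron of the STT LP for $U$ has a non-integer vertex, then so does the polyhedron of the STT LP for $U'$. The same holds when only the depths are considered: if the projection of the LP polyhedron of $U$ onto the $D$ coordinates has a non-integer vertex, then so does the corresponding projection for $U'$.
   Context: A single extension of a tree $G$ to $G'$ adds one new node to $G$ either as a new leaf attached to an existing node or by subdividing an existing edge into two edges through the new node. $G$ extends $H$ if there is a sequence of $|G|-|H|$ single extensions $H\to H'\to\dots\to G$. For a tree $U$ and distinct nodes $i,j$, $(i\leftrightsquigarrow j)$ denotes the nodes strictly between $i$ and $j$ on the $U$-path. The STT LP for $U$ has variables $D_i$, $X_{ij}$ ($i\ne j$), $Z_{kij}=Z_{kji}$ ($k\in(i\leftrightsquigarrow j)$); constraints $X,Z\ge0$; $X_{ij}+X_{ji}+\sum_{k\in(i\leftrightsquigarrow j)}Z_{kij}\ge1$ for all $i\ne j$; $Z_{kij}\le X_{ki}$, $Z_{kij}\le X_{kj}$; $D_i\ge\sum_{j\ne i}X_{ji}$.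
   Formalization: The LP polyhedra and their projections onto the D coordinates are taken over the rational numbers, and a vertex is an extreme point among rational points; since the LP has rational data, these are the same vertices as over the reals. -}

module Defs where

open import Data.Nat using (ℕ; zero; suc; _≤_)
open import Data.Fin using (Fin; zero; suc)
open import Data.Integer using (ℤ)
open import Data.Rational using (ℚ; 0ℚ; 1ℚ; _+_; _*_; _-_; _/_) renaming (_≤_ to _≤ℚ_; _<_ to _<ℚ_)
open import Data.List using (List; []; _∷_; length)
open import Data.List.Membership.Propositional using (_∈_)
open import Data.List.Relation.Unary.Unique.Propositional using (Unique)
open import Data.Product using (Σ; ∃; _×_; _,_)
open import Data.Sum using (_⊎_)
open import Relation.Nullary using (¬_)
open import Relation.Binary.PropositionalEquality using (_≡_; _≢_)
open import Function.Bundles using (_⇔_)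

data Walk {n : ℕ} (Adj : Fin n → Fin n → Set) : Fin n → Fin n → List (Fin n) → Set where
  here : ∀ {i} → Walk Adj i i (i ∷ [])
  step : ∀ {i j k vs} → Adj i j → Walk Adj j k vs → Walk Adj i k (i ∷ vs)

record Tree (n : ℕ) : Set₁ where
  field
    Adj       : Fin n → Fin n → Set
    sym       : ∀ {i j} → Adj i j → Adj j i
    irrefl    : ∀ {i} → ¬ Adj i i
    connected : ∀ i j → ∃ λ vs → Walk Adj i j vs
    acyclic   : ∀ {u v vs} → Walk Adj v u vs → Unique vs → 3 ≤ length vs → ¬ Adj u v
open Tree public

Between : ∀ {n} → Tree n → Fin n → Fin n → Fin n → Set
Between U k i j =
  Σ (List _) λ vs → Walk (Adj U) i j vs × Unique vs × k ∈ vs × k ≢ i × k ≢ j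

-- single extension of T (n nodes) to T' (n+1 nodes), up to relabelling:
-- ι is a bijection from Fin n onto all nodes of T' except the new node w.
data SingleExt {n : ℕ} (T : Tree n) (T' : Tree (suc n)) : Set where
  leaf : (ι : Fin n → Fin (suc n)) (w : Fin (suc n)) (v : Fin n) →
         (∀ a b → ι a ≡ ι b → a ≡ b) →
         (∀ a → ι a ≢ w) →
         (∀ y → y ≡ w ⊎ ∃ λ a → ι a ≡ y) →
         (∀ a b → Adj T' (ι a) (ι b) ⇔ Adj T a b) →
         (∀ a → Adj T' w (ι a) ⇔ (a ≡ v)) →
         SingleExt T T'
  subdivide : (ι : Fin n → Fin (suc n)) (w : Fin (suc n)) (a₀ b₀ : Fin n) →
         Adj T a₀ b₀ →
         (∀ a b → ι a ≡ ι b → a ≡ b) →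
         (∀ a → ι a ≢ w) →
         (∀ y → y ≡ w ⊎ ∃ λ a → ι a ≡ y) →
         (∀ a b → Adj T' (ι a) (ι b) ⇔
                  (Adj T a b × ¬ ((a ≡ a₀ × b ≡ b₀) ⊎ (a ≡ b₀ × b ≡ a₀)))) →
         (∀ a → Adj T' w (ι a) ⇔ (a ≡ a₀ ⊎ a ≡ b₀)) →
         SingleExt T T'

data Extends {m : ℕ} (H : Tree m) : {n : ℕ} → Tree n → Set₁ where
  done : Extends H H
  more : ∀ {n} {G : Tree n} {G' : Tree (suc n)} →
         Extends H G → SingleExt G G' → Extends H G'

IsInt : ℚ → Set
IsInt q = Σ ℤ λ z → q ≡ z / 1

IsVertex : {C : Set} → ((C → ℚ) → Set) → (C → ℚ) → Set
IsVertex {C} P x =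
  P x ×
  (∀ (y z : C → ℚ) (λ' : ℚ) → 0ℚ <ℚ λ' → λ' <ℚ 1ℚ → P y → P z →
     (∀ c → x c ≡ λ' * y c + (1ℚ - λ') * z c) → ∀ c → y c ≡ z c)

HasNonIntVertex : {C : Set} → ((C → ℚ) → Set) → Set
HasNonIntVertex {C} P = Σ (C → ℚ) λ x → IsVertex P x × Σ C λ c → ¬ IsInt (x c)

data Coord (n : ℕ) : Set where
  D : Fin n → Coord n
  X : Fin n → Fin n → Coord n
  Z : Fin n → Fin n → Fin n → Coord n

∑ : ∀ {n} → (Fin n → ℚ) → ℚ
∑ {zero}  f = 0ℚ
∑ {suc n} f = f zero + ∑ (λ i → f (suc i))

-- feasible region of the STT LP for U.  Coordinates that are not LP variables
-- (X i i, and Z k i j with k ∉ (i ↭ j)) are pinned to 0, and Z k j i is pinned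
-- to the value of Z k i j (the single variable Z_kij = Z_kji).
STT : ∀ {n} → Tree n → (Coord n → ℚ) → Set
STT {n} U x =
  (∀ i j → i ≢ j → 0ℚ ≤ℚ x (X i j)) ×
  (∀ i → x (X i i) ≡ 0ℚ) ×
  (∀ k i j → ¬ Between U k i j → x (Z k i j) ≡ 0ℚ) ×
  (∀ k i j → Between U k i j → 0ℚ ≤ℚ x (Z k i j)) ×
  (∀ k i j → Between U k i j → x (Z k i j) ≡ x (Z k j i)) ×
  (∀ i j → i ≢ j →
     1ℚ ≤ℚ x (X i j) + x (X j i) + ∑ (λ k → x (Z k i j))) ×
  (∀ k i j → Between U k i j → x (Z k i j) ≤ℚ x (X k i)) ×
  (∀ k i j → Between U k i j → x (Z k i j) ≤ℚ x (X k j)) ×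
  (∀ i → ∑ (λ j → x (X j i)) ≤ℚ x (D i))

STT-D : ∀ {n} → Tree n → (Fin n → ℚ) → Set
STT-D U d = Σ (Coord _ → ℚ) λ x → STT U x × (∀ i → x (D i) ≡ d i)

{-# OPTIONS --safe #-}
-- It suffices to treat a single extension, adding a node w to U.  Any feasible point x
-- of U extends to U′ by placing w below all other nodes (X_iw = 1, X_wi = 0, Z = 0
-- whenever w is involved).  Conversely, contracting w into a neighbour a₀, that is adding
-- X_wi to X_{a₀i} and Z_wij to Z_{a₀ij}, maps feasible points of U′ to feasible points of
-- U without changing the depths of the old nodes.
--
-- If x is a vertex, then so is its extension: the zeros force the two ends of a segment
-- through it to agree in all coordinates involving w, and on the old coordinates the
-- contraction reduces to x being a vertex.  For the depths, a vertex d of the projection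
-- for U has as fibre a face of the projection for U′ on which only D_w varies; D_w
-- attains its minimum there (by Fourier–Motzkin elimination over ℚ), and the minimum is
-- a vertex extending d.
module Submission where

open import Defs hiding (sym)
import Algebra.Properties.CommutativeMonoid.Sum as CommutativeMonoidSum
open import Data.Bool using (if_then_else_)
open import Data.Fin as Fin using (Fin; zero; suc; punchIn; punchOut)
open import Data.Fin.Permutation using (Permutation; permutation)
import Data.Fin.Properties as Fin
open import Data.List using (List; []; _∷_; _++_; length; lookup; map; filter; allFin; cartesianProduct; cartesianProductWith)
import Data.List.Membership.DecPropositional as DecMembership
open import Data.List.Membership.Propositional using (_∈_; _∉_)
open import Data.List.Membership.Propositional.Properties
open import Data.List.Relation.Unary.All using ([]; _∷_)
open import Data.List.Relation.Unary.All.Properties using (¬Any⇒All¬; All¬⇒¬Any)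
open import Data.List.Relation.Unary.AllPairs using ([]; _∷_)
open import Data.List.Relation.Unary.Any using (here; there)
import Data.List.Relation.Unary.Unique.DecPropositional as DecUnique
open import Data.List.Relation.Unary.Unique.Propositional using (Unique)
open import Data.Maybe using (Maybe; just; nothing)
open import Data.Nat as ℕ using (ℕ; zero; suc; z≤n; s≤s)
open import Data.Product using (∃; _×_; _,_; proj₁; proj₂; map₂; uncurry)
open import Data.Rational as ℚ using (ℚ; 0ℚ; 1ℚ; _+_; _*_; _-_; -_; _≤_; _<_; _⊔_; _⊓_)
open import Data.Rational.Properties as ℚ hiding (_≟_)
open import Data.Rational.Solver using (module +-*-Solver)
open import Data.Sum using (_⊎_; inj₁; inj₂; [_,_]′)
open import Function using (_∘_)
open import Function.Bundles using (_⇔_; mk⇔; Equivalence)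
open import Relation.Binary using (DecidableEquality; tri<; tri≈; tri>)
open import Relation.Binary.PropositionalEquality as ≡ using (_≡_; _≢_; refl; sym; trans; cong; cong₂; subst; subst₂)
open import Relation.Nullary using (Dec; yes; no; ¬_; ¬?; does; contradiction)
open import Relation.Nullary.Decidable using (_×-dec_; _⊎-dec_; map′)
open import Relation.Unary using (Decidable)
open +-*-Solver using (solve; con; _:+_; _:*_; _:-_; :-_; _:=_)

-- Order arithmetic in ℚ

0≤⇒*-monoˡ-≤ : ∀ {r p q} → 0ℚ ≤ r → p ≤ q → r * p ≤ r * q
0≤⇒*-monoˡ-≤ {r} 0≤r = *-monoˡ-≤-nonNeg r {{ℚ.nonNegative 0≤r}}

0≤p∧0≤q⇒0≤p*q : ∀ {p q} → 0ℚ ≤ p → 0ℚ ≤ q → 0ℚ ≤ p * q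
0≤p∧0≤q⇒0≤p*q {p} {q} 0≤p 0≤q = subst (_≤ p * q) (*-zeroʳ p) (0≤⇒*-monoˡ-≤ 0≤p 0≤q)

0≤p∧0≤q⇒0≤p+q : ∀ {p q} → 0ℚ ≤ p → 0ℚ ≤ q → 0ℚ ≤ p + q
0≤p∧0≤q⇒0≤p+q = +-mono-≤

p≤q⇒0≤q-p : ∀ {p q} → p ≤ q → 0ℚ ≤ q - p
p≤q⇒0≤q-p {p} {q} p≤q = subst (_≤ q - p) (+-inverseʳ p) (+-monoˡ-≤ (- p) p≤q)

0≤q-p⇒p≤q : ∀ {q p} → 0ℚ ≤ q - p → p ≤ q
0≤q-p⇒p≤q {q} {p} h = subst₂ _≤_ (+-identityˡ p) (solve 2 (λ q p → q :- p :+ p := q) refl q p) (+-monoˡ-≤ p h)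

-- Fourier–Motzkin elimination

-- p / a, with the junk value 0 for a = 0
infixl 7 _÷₀_
abstract
  _÷₀_ : ℚ → ℚ → ℚ
  p ÷₀ a with a ℚ.≟ 0ℚ
  ... | yes _   = 0ℚ
  ... | no  a≢0 = p * (ℚ.1/ a) {{ℚ.≢-nonZero a≢0}}

  *-÷₀ : ∀ p {a} → a ≢ 0ℚ → a * (p ÷₀ a) ≡ p
  *-÷₀ p {a} a≢0 with a ℚ.≟ 0ℚ
  ... | yes a≡0 = contradiction a≡0 a≢0
  ... | no  a≢0 = trans (solve 3 (λ a p i → a :* (p :* i) := p :* (a :* i)) refl a p a⁻¹)
                        (trans (cong (p *_) (*-inverseʳ a {{ℚ.≢-nonZero a≢0}})) (*-identityʳ p))
    where a⁻¹ : ℚ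
          a⁻¹ = (ℚ.1/ a) {{ℚ.≢-nonZero a≢0}}

-- With positive slope the root `- p ÷₀ a` is a lower end point for `s`; with negative slope it is
-- an upper one.
pos-halfline : ∀ {s} a p → 0ℚ < a → - p ÷₀ a ≤ s → 0ℚ ≤ p + a * s
pos-halfline {s} a p 0<a r≤s = begin
  0ℚ                   ≡⟨ +-inverseʳ p ⟨
  p + - p              ≡⟨ cong (p +_) (*-÷₀ (- p) (<⇒≢ 0<a ∘ sym)) ⟨
  p + a * (- p ÷₀ a)   ≤⟨ +-monoʳ-≤ p (0≤⇒*-monoˡ-≤ (<⇒≤ 0<a) r≤s) ⟩
  p + a * s            ∎
  where open ≤-Reasoning

pos-halfline⁻¹ : ∀ {s} a p → 0ℚ < a → 0ℚ ≤ p + a * s → - p ÷₀ a ≤ s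
pos-halfline⁻¹ {s} a p 0<a 0≤p+as = *-cancelˡ-≤-pos a {{ℚ.positive 0<a}} (begin
  a * (- p ÷₀ a)   ≡⟨ *-÷₀ (- p) (<⇒≢ 0<a ∘ sym) ⟩
  - p              ≤⟨ 0≤q-p⇒p≤q (subst (0ℚ ≤_) (solve 2 (λ p as → p :+ as := as :- :- p) refl p (a * s)) 0≤p+as) ⟩
  a * s            ∎)
  where open ≤-Reasoning

nonpos-antitone : ∀ {s t} a p → a ≤ 0ℚ → s ≤ t → 0ℚ ≤ p + a * t → 0ℚ ≤ p + a * s
nonpos-antitone {s} {t} a p a≤0 s≤t h =
  ≤-trans h (+-monoʳ-≤ p (*-monoˡ-≤-nonPos a {{ℚ.nonPositive a≤0}} s≤t))

neg-halfline : ∀ {s} a p → a < 0ℚ → s ≤ - p ÷₀ a → 0ℚ ≤ p + a * s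
neg-halfline {s} a p a<0 s≤r = nonpos-antitone a p (<⇒≤ a<0) s≤r
  (≤-reflexive (sym (trans (cong (p +_) (*-÷₀ (- p) (<⇒≢ a<0))) (+-inverseʳ p))))

-- At the root `ρ` of the second function, `- b` times the value of the first is exactly the
-- hypothesis `(- b) * p + a * q`. So the first constraint holds at `ρ`, and its own root lies below
-- `ρ`.
crossing : ∀ a b p q → 0ℚ < a → b < 0ℚ → 0ℚ ≤ (- b) * p + a * q → - p ÷₀ a ≤ - q ÷₀ b
crossing a b p q 0<a b<0 h = pos-halfline⁻¹ a p 0<a (*-cancelˡ-≤-pos (- b) {{ℚ.positive (neg-antimono-< b<0)}} (begin
  - b * 0ℚ                  ≡⟨ *-zeroʳ (- b) ⟩
  0ℚ                        ≤⟨ h ⟩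
  - b * p + a * q           ≡⟨ solve 4 (λ a b p q → :- b :* p :+ a :* q := :- b :* p :+ :- a :* (:- q)) refl a b p q ⟩
  - b * p + - a * (- q)     ≡⟨ cong (λ z → - b * p + - a * z) (*-÷₀ (- q) (<⇒≢ b<0)) ⟨
  - b * p + - a * (b * ρ)   ≡⟨ solve 4 (λ a b p r → :- b :* p :+ :- a :* (b :* r) := :- b :* (p :+ a :* r)) refl a b p ρ ⟩
  - b * (p + a * ρ)         ∎))
  where open ≤-Reasoning
        ρ = - q ÷₀ b

lower-bound : (us : List ℚ) → ∃ λ s → ∀ {u} → u ∈ us → s ≤ u
lower-bound []       = 0ℚ , λ ()
lower-bound (u ∷ us) with s , s≤ ← lower-bound us =
  s ⊓ u , λ { (here refl) → p⊓q≤q s u ; (there u∈) → ≤-trans (p⊓q≤p s u) (s≤ u∈) }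

-- The point is a running maximum of the lower bounds, started below all upper bounds so that an
-- empty `ls` causes no trouble.
separate : (ls us : List ℚ) → (∀ {l u} → l ∈ ls → u ∈ us → l ≤ u) →
  ∃ λ s → (∀ {l} → l ∈ ls → l ≤ s) × (∀ {u} → u ∈ us → s ≤ u)
separate []       us _ with s , s≤ ← lower-bound us = s , (λ ()) , s≤
separate (l ∷ ls) us l≤u with s , ≤s , s≤ ← separate ls us (λ l∈ → l≤u (there l∈)) =
  s ⊔ l ,
  (λ { (here refl) → p≤q⊔p s l ; (there l∈) → ≤-trans (≤s l∈) (p≤p⊔q s l) }) ,
  (λ u∈ → ⊔-lub (s≤ u∈) (l≤u (here refl) u∈))

least-upper-bound : ∀ p q → ∃ λ m → p ≤ m × q ≤ m × (∀ t → p ≤ t → q ≤ t → m ≤ t)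
least-upper-bound p q = p ⊔ q , p≤p⊔q p q , p≤q⊔p p q , λ _ → ⊔-lub

-- Systems of affine constraints in one variable

module _ {A : Set} (E c : A → ℚ) where

  On : List A → ℚ → Set
  On L s = ∀ {e} → e ∈ L → 0ℚ ≤ E e + c e * s

  -- Helly's theorem on the line: half-lines meet as soon as each left end point is at most each
  -- right end point. Through `crossing`, `cross` says this without division, in the form that
  -- elimination produces.
  common-point : (L : List A) →
    (∀ {e} → e ∈ L → c e ≡ 0ℚ → 0ℚ ≤ E e) →
    (∀ {e f} → e ∈ L → f ∈ L → 0ℚ < c e → c f < 0ℚ → 0ℚ ≤ - c f * E e + c e * E f) →
    ∃ (On L)
  common-point L flat cross = s₀ , on
    where
    root : A → ℚ
    root e = - E e ÷₀ c e
    pos? = λ e → 0ℚ <? c e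
    neg? = λ e → c e <? 0ℚ
    ordered : ∀ {l u} → l ∈ map root (filter pos? L) → u ∈ map root (filter neg? L) → l ≤ u
    ordered l∈ u∈
      with e , e∈ , refl ← ∈-map⁻ root l∈ | f , f∈ , refl ← ∈-map⁻ root u∈
      with e∈L , 0<ce ← ∈-filter⁻ pos? {xs = L} e∈ | f∈L , cf<0 ← ∈-filter⁻ neg? {xs = L} f∈
      = crossing (c e) (c f) (E e) (E f) 0<ce cf<0 (cross e∈L f∈L 0<ce cf<0)
    sep = separate (map root (filter pos? L)) (map root (filter neg? L)) ordered
    s₀ = proj₁ sep
    on : On L s₀
    on {e} e∈ with <-cmp (c e) 0ℚ
    ... | tri< ce<0 _ _ = neg-halfline (c e) (E e) ce<0 (proj₂ (proj₂ sep) (∈-map⁺ root (∈-filter⁺ neg? e∈ ce<0)))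
    ... | tri> _ _ 0<ce = pos-halfline (c e) (E e) 0<ce (proj₁ (proj₂ sep) (∈-map⁺ root (∈-filter⁺ pos? e∈ 0<ce)))
    ... | tri≈ _ ce≡0 _ = subst (0ℚ ≤_) (sym (trans (cong (λ z → E e + z * s₀) ce≡0)
                            (solve 2 (λ p s → p :+ con 0ℚ :* s := p) refl (E e) s₀))) (flat e∈ ce≡0)

  -- The floor `l` collects the lower bounds met so far, so that the constraint list can be
  -- processed one entry at a time.
  IsMin : List A → ℚ → ℚ → Set
  IsMin L l s = l ≤ s × On L s × (∀ t → l ≤ t → On L t → s ≤ t)

  -- A constraint with positive coefficient is itself a lower bound, so it is absorbed by raising
  -- the floor from `l` to the join `m` of `l` and its root.
  minimum-pos : ∀ {e L l m s} → 0ℚ < c e → l ≤ m → - E e ÷₀ c e ≤ m →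
    (∀ t → l ≤ t → - E e ÷₀ c e ≤ t → m ≤ t) → IsMin L m s → IsMin (e ∷ L) l s
  minimum-pos {e} {L} {l} {m} {s} 0<ce l≤m r≤m lub (m≤s , on , least) = ≤-trans l≤m m≤s , on′ , least′
    where
    on′ : On (e ∷ L) s
    on′ (here refl)    = pos-halfline {s} (c e) (E e) 0<ce (≤-trans r≤m m≤s)
    on′ {f} (there f∈) = on {f} f∈
    least′ : ∀ t → l ≤ t → On (e ∷ L) t → s ≤ t
    least′ t l≤t onₜ = least t (lub t l≤t (pos-halfline⁻¹ {t} (c e) (E e) 0<ce (onₜ {e} (here refl))))
                               (λ {f} f∈ → onₜ {f} (there f∈))

  -- A constraint with c e ≤ 0 holds at every point below a feasible one, so it
  -- cannot push the minimum up.
  minimum-nonpos : ∀ {e L l s} s₀ → c e ≤ 0ℚ → l ≤ s₀ → On (e ∷ L) s₀ → IsMin L l s → IsMin (e ∷ L) l s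
  minimum-nonpos {e} {L} {l} {s} s₀ ce≤0 l≤s₀ on₀ (l≤s , on , least) =
    l≤s , on′ , λ t l≤t onₜ → least t l≤t (λ {f} f∈ → onₜ {f} (there f∈))
    where
    on′ : On (e ∷ L) s
    on′ (here refl)    = nonpos-antitone {s} {s₀} (c e) (E e) ce≤0
                           (least s₀ l≤s₀ (λ {f} f∈ → on₀ {f} (there f∈))) (on₀ {e} (here refl))
    on′ {f} (there f∈) = on {f} f∈

  -- The minimum is the final floor, once every constraint with positive coefficient has raised it.
  -- The feasible point `s₀` guarantees that the remaining constraints hold there.
  minimum : ∀ L l s₀ → l ≤ s₀ → On L s₀ → ∃ (IsMin L l)
  minimum []      l s₀ _    _  = l , ≤-refl , (λ ()) , λ _ l≤t _ → l≤t
  minimum (e ∷ L) l s₀ l≤s₀ on = split (0ℚ <? c e)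
    where
    on′ : On L s₀
    on′ {f} f∈ = on {f} (there f∈)
    raise : 0ℚ < c e → (∃ λ m → l ≤ m × - E e ÷₀ c e ≤ m × (∀ t → l ≤ t → - E e ÷₀ c e ≤ t → m ≤ t)) →
      ∃ (IsMin (e ∷ L) l)
    raise 0<ce (m , l≤m , r≤m , lub) = map₂ (minimum-pos 0<ce l≤m r≤m lub)
      (minimum L m s₀ (lub s₀ l≤s₀ (pos-halfline⁻¹ {s₀} (c e) (E e) 0<ce (on {e} (here refl)))) on′)
    split : Dec (0ℚ < c e) → ∃ (IsMin (e ∷ L) l)
    split (yes 0<ce) = raise 0<ce (least-upper-bound l (- E e ÷₀ c e))
    split (no  0≮ce) = map₂ (minimum-nonpos s₀ (≮⇒≥ 0≮ce) l≤s₀ on) (minimum L l s₀ l≤s₀ on′)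

-- Elimination of variables from finite systems of linear inequalities

∑-cong : ∀ {n} {f g : Fin n → ℚ} → (∀ i → f i ≡ g i) → ∑ f ≡ ∑ g
∑-cong {zero}  f≗g = refl
∑-cong {suc n} f≗g = cong₂ _+_ (f≗g zero) (∑-cong (f≗g ∘ suc))

∑-affine : ∀ {n} (f g : Fin n → ℚ) s → ∑ (λ i → f i + g i * s) ≡ ∑ f + ∑ g * s
∑-affine {zero}  f g s = solve 1 (λ s → con 0ℚ := con 0ℚ :+ con 0ℚ :* s) refl s
∑-affine {suc n} f g s = trans (cong (f zero + g zero * s +_) (∑-affine (f ∘ suc) (g ∘ suc) s))
  (solve 5 (λ f g F G s → f :+ g :* s :+ (F :+ G :* s) := f :+ F :+ (g :+ G) :* s) refl
    (f zero) (g zero) (∑ (f ∘ suc)) (∑ (g ∘ suc)) s)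

module FourierMotzkin {V : Set} (_≟_ : DecidableEquality V) where

  Point : Set
  Point = V → ℚ

  _[_↦_] : Point → V → ℚ → Point
  (x [ v ↦ t ]) u = if does (u ≟ v) then t else x u

  infixl 6 _⊕_
  infixl 7 _⊛_

  -- Linear expressions are kept as syntax because elimination has to compute the coefficient of a
  -- variable; `sum` mirrors the `∑` of the LP constraints.
  data Expr : Set where
    var     : V → Expr
    const   : ℚ → Expr
    _⊕_     : Expr → Expr → Expr
    _⊛_     : ℚ → Expr → Expr
    sum     : ∀ {n} → (Fin n → Expr) → Expr

  ⟦_⟧ : Expr → Point → ℚ
  ⟦ var v ⟧   x = x v
  ⟦ const q ⟧ x = q
  ⟦ e ⊕ f ⟧   x = ⟦ e ⟧ x + ⟦ f ⟧ x
  ⟦ q ⊛ e ⟧   x = q * ⟦ e ⟧ x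
  ⟦ sum f ⟧   x = ∑ (λ i → ⟦ f i ⟧ x)

  coeff : V → Expr → ℚ
  coeff v (var u)   = if does (u ≟ v) then 1ℚ else 0ℚ
  coeff v (const q) = 0ℚ
  coeff v (e ⊕ f)   = coeff v e + coeff v f
  coeff v (q ⊛ e)   = q * coeff v e
  coeff v (sum f)   = ∑ (λ i → coeff v (f i))

  ⟦⟧-cong : ∀ e {x y} → (∀ v → x v ≡ y v) → ⟦ e ⟧ x ≡ ⟦ e ⟧ y
  ⟦⟧-cong (var v)   x≗y = x≗y v
  ⟦⟧-cong (const q) x≗y = refl
  ⟦⟧-cong (e ⊕ f)   x≗y = cong₂ _+_ (⟦⟧-cong e x≗y) (⟦⟧-cong f x≗y)
  ⟦⟧-cong (q ⊛ e)   x≗y = cong (q *_) (⟦⟧-cong e x≗y)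
  ⟦⟧-cong (sum f)   x≗y = ∑-cong (λ i → ⟦⟧-cong (f i) x≗y)

  ⟦⟧-update : ∀ e x v t → ⟦ e ⟧ (x [ v ↦ t ]) ≡ ⟦ e ⟧ x + coeff v e * (t - x v)
  ⟦⟧-update (var u) x v t with u ≟ v
  ... | yes refl = solve 2 (λ t s → t := s :+ con 1ℚ :* (t :- s)) refl t (x v)
  ... | no  _    = solve 3 (λ t s u → u := u :+ con 0ℚ :* (t :- s)) refl t (x v) (x u)
  ⟦⟧-update (const q) x v t = solve 2 (λ q s → q := q :+ con 0ℚ :* s) refl q (t - x v)
  ⟦⟧-update (e ⊕ f) x v t = trans (cong₂ _+_ (⟦⟧-update e x v t) (⟦⟧-update f x v t))
    (solve 5 (λ e f a b s → e :+ a :* s :+ (f :+ b :* s) := e :+ f :+ (a :+ b) :* s) refl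
      (⟦ e ⟧ x) (⟦ f ⟧ x) (coeff v e) (coeff v f) (t - x v))
  ⟦⟧-update (q ⊛ e) x v t = trans (cong (q *_) (⟦⟧-update e x v t))
    (solve 4 (λ q e a s → q :* (e :+ a :* s) := q :* e :+ q :* a :* s) refl q (⟦ e ⟧ x) (coeff v e) (t - x v))
  ⟦⟧-update (sum f) x v t = trans (∑-cong (λ i → ⟦⟧-update (f i) x v t))
    (∑-affine (λ i → ⟦ f i ⟧ x) (λ i → coeff v (f i)) (t - x v))

  Sat : List Expr → Point → Set
  Sat L x = ∀ {e} → e ∈ L → 0ℚ ≤ ⟦ e ⟧ x

  -- Measuring the change of `v` by the increment `t - x v` makes the constant term the value at `x`
  -- itself, so `v` never has to be removed from an expression.
  Sat-shift : ∀ L x v t → Sat L (x [ v ↦ t ]) ⇔ On (λ e → ⟦ e ⟧ x) (coeff v) L (t - x v)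
  Sat-shift L x v t = mk⇔ (λ sat {e} e∈ → subst (0ℚ ≤_) (⟦⟧-update e x v t) (sat e∈))
                          (λ on {e} e∈ → subst (0ℚ ≤_) (sym (⟦⟧-update e x v t)) (on e∈))

  -- The coefficient of `v` cancels here. For a positive coefficient in `e` and a negative one in
  -- `f`, both multipliers are positive.
  combine : V → Expr → Expr → Expr
  combine v e f = (- coeff v f) ⊛ e ⊕ coeff v e ⊛ f

  flat? : ∀ v e → Dec (coeff v e ≡ 0ℚ)
  flat? v e = coeff v e ℚ.≟ 0ℚ

  pos? : ∀ v e → Dec (0ℚ < coeff v e)
  pos? v e = 0ℚ <? coeff v e

  neg? : ∀ v e → Dec (coeff v e < 0ℚ)
  neg? v e = coeff v e <? 0ℚ

  eliminate : V → List Expr → List Expr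
  eliminate v L = filter (flat? v) L
    ++ cartesianProductWith (combine v) (filter (pos? v) L) (filter (neg? v) L)

  eliminate-sound : ∀ v L x → Sat (eliminate v L) x → ∃ λ t → Sat L (x [ v ↦ t ])
  eliminate-sound v L x sat =
    -- `common-point` yields an increment; adding `x v` turns it into a value of the variable.
    s₀ + x v , Equivalence.from (Sat-shift L x v (s₀ + x v))
      (subst (On (λ e → ⟦ e ⟧ x) (coeff v) L) (solve 2 (λ s y → s := s :+ y :- y) refl s₀ (x v)) (proj₂ common))
    where
    common : ∃ (On (λ e → ⟦ e ⟧ x) (coeff v) L)
    common = common-point (λ e → ⟦ e ⟧ x) (coeff v) L
      (λ e∈ flat → sat (∈-++⁺ˡ (∈-filter⁺ (flat? v) e∈ flat)))
      (λ {e} {f} e∈ f∈ 0<ce cf<0 → sat {combine v e f} (∈-++⁺ʳ (filter (flat? v) L)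
        (∈-cartesianProductWith⁺ (combine v) (∈-filter⁺ (pos? v) e∈ 0<ce) (∈-filter⁺ (neg? v) f∈ cf<0))))
    s₀ = proj₁ common

  -- Neither flat constraints nor combined ones depend on `v`, so they may be evaluated at the
  -- updated point, where they are nonnegative combinations of constraints of `L`.
  eliminate-complete : ∀ v L x t → Sat L (x [ v ↦ t ]) → Sat (eliminate v L) x
  eliminate-complete v L x t sat {g} g∈ = split (∈-++⁻ (filter (flat? v) L) g∈)
    where
    on : On (λ e → ⟦ e ⟧ x) (coeff v) L (t - x v)
    on = Equivalence.to (Sat-shift L x v t) sat
    from-flat : g ∈ L × coeff v g ≡ 0ℚ → 0ℚ ≤ ⟦ g ⟧ x
    from-flat (g∈L , flat) = subst (0ℚ ≤_) (trans (cong (λ z → ⟦ g ⟧ x + z * (t - x v)) flat)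
      (solve 2 (λ p s → p :+ con 0ℚ :* s := p) refl (⟦ g ⟧ x) (t - x v))) (on {g} g∈L)
    from-pair : ∀ {e f} → e ∈ L × 0ℚ < coeff v e → f ∈ L × coeff v f < 0ℚ → 0ℚ ≤ ⟦ combine v e f ⟧ x
    from-pair {e} {f} (e∈L , 0<ce) (f∈L , cf<0) = subst (0ℚ ≤_)
      (solve 5 (λ p q a b s → (:- b) :* (p :+ a :* s) :+ a :* (q :+ b :* s) := (:- b) :* p :+ a :* q) refl
        (⟦ e ⟧ x) (⟦ f ⟧ x) (coeff v e) (coeff v f) (t - x v))
      (0≤p∧0≤q⇒0≤p+q
        (0≤p∧0≤q⇒0≤p*q (<⇒≤ (neg-antimono-< cf<0)) (on {e} e∈L))
        (0≤p∧0≤q⇒0≤p*q (<⇒≤ 0<ce) (on {f} f∈L)))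
    split : g ∈ filter (flat? v) L ⊎ g ∈ cartesianProductWith (combine v) (filter (pos? v) L) (filter (neg? v) L) →
      0ℚ ≤ ⟦ g ⟧ x
    split (inj₁ g∈) = from-flat (∈-filter⁻ (flat? v) g∈)
    split (inj₂ g∈) =
      let e , f , e∈ , f∈ , g≡ = ∈-cartesianProductWith⁻ (combine v) (filter (pos? v) L) (filter (neg? v) L) g∈
      in subst (λ h → 0ℚ ≤ ⟦ h ⟧ x) (sym g≡) (from-pair (∈-filter⁻ (pos? v) e∈) (∈-filter⁻ (neg? v) f∈))

  AgreeOff : List V → Point → Point → Set
  AgreeOff vs x y = ∀ {u} → u ∉ vs → x u ≡ y u

  update-same : ∀ (x : Point) v t → (x [ v ↦ t ]) v ≡ t
  update-same x v t with v ≟ v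
  ... | yes _  = refl
  ... | no v≢v = contradiction refl v≢v

  update-other : ∀ (x : Point) {u v} t → u ≢ v → (x [ v ↦ t ]) u ≡ x u
  update-other x {u} {v} t u≢v with u ≟ v
  ... | yes u≡v = contradiction u≡v u≢v
  ... | no _    = refl

  agree-update⁺ : ∀ {vs x y} v → AgreeOff (v ∷ vs) x y → AgreeOff vs (x [ v ↦ y v ]) y
  agree-update⁺ {x = x} {y} v agree {u} u∉ with u ≟ v
  ... | yes refl = refl
  ... | no  u≢v  = agree (λ { (here u≡v) → u≢v u≡v ; (there u∈) → u∉ u∈ })

  agree-update⁻ : ∀ {vs x y} v t → AgreeOff vs (x [ v ↦ t ]) y → AgreeOff (v ∷ vs) x y
  agree-update⁻ {x = x} v t agree u∉ =
    trans (sym (update-other x t (u∉ ∘ here))) (agree (u∉ ∘ there))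

  eliminateAll : List V → List Expr → List Expr
  eliminateAll []       L = L
  eliminateAll (v ∷ vs) L = eliminate v (eliminateAll vs L)

  -- Values for the eliminated variables are recovered in the reverse order of elimination,
  -- outermost first.
  eliminateAll-sound : ∀ vs L x → Sat (eliminateAll vs L) x → ∃ λ y → Sat L y × AgreeOff vs x y
  eliminateAll-sound []       L x sat = x , sat , λ _ → refl
  eliminateAll-sound (v ∷ vs) L x sat = extend (eliminate-sound v (eliminateAll vs L) x sat)
    where
    extend : (∃ λ t → Sat (eliminateAll vs L) (x [ v ↦ t ])) → ∃ λ y → Sat L y × AgreeOff (v ∷ vs) x y
    extend (t , sat′) = map₂ (map₂ (agree-update⁻ v t)) (eliminateAll-sound vs L (x [ v ↦ t ]) sat′)

  -- The point `x` is moved towards `y` one coordinate of `vs` at a time; once the list is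
  -- exhausted, the two agree everywhere.
  eliminateAll-complete : ∀ vs L x y → Sat L y → AgreeOff vs x y → Sat (eliminateAll vs L) x
  eliminateAll-complete []       L x y sat agree {e} e∈ =
    subst (0ℚ ≤_) (sym (⟦⟧-cong e (λ v → agree (λ ())))) (sat e∈)
  eliminateAll-complete (v ∷ vs) L x y sat agree =
    eliminate-complete v (eliminateAll vs L) x (y v)
      (eliminateAll-complete vs L (x [ v ↦ y v ]) y sat (agree-update⁺ v agree))

  -- Minimising one coordinate while others are free

  Minimiser : List Expr → List V → V → Point → Point → Set
  Minimiser L vs v x₀ x = Sat L x × AgreeOff (v ∷ vs) x₀ x ×
    (∀ y → Sat L y → AgreeOff (v ∷ vs) x₀ y → x v ≤ y v)

  -- Eliminating `vs` leaves a system in `v` alone along the line through `x₀`, whose minimum is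
  -- found by `minimum` and lifted back. Since `v` is not among `vs`, lifting does not disturb its
  -- value.
  minimise : ∀ L vs v x₀ → v ∉ vs → Sat L x₀ → (∀ y → Sat L y → 0ℚ ≤ y v) →
    ∃ (Minimiser L vs v x₀)
  minimise L vs v x₀ v∉ sat₀ bounded = attain
    -- Everything is measured in increments from `x₀ v`: the bound `0ℚ` on `v` becomes the floor
    -- `0ℚ - x₀ v`, and `x₀` itself is the feasible increment.
    (minimum (λ e → ⟦ e ⟧ x₀) (coeff v) M (0ℚ - x₀ v) (x₀ v - x₀ v)
      (+-monoˡ-≤ (- x₀ v) (bounded x₀ sat₀)) (onLine x₀ sat₀ (λ _ → refl)))
    where
    M : List Expr
    M = eliminateAll vs L
    onLine : ∀ y → Sat L y → AgreeOff (v ∷ vs) x₀ y → On (λ e → ⟦ e ⟧ x₀) (coeff v) M (y v - x₀ v)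
    onLine y saty agree = Equivalence.to (Sat-shift M x₀ v (y v))
      (eliminateAll-complete vs L (x₀ [ v ↦ y v ]) y saty (agree-update⁺ v agree))
    lift-to : ∀ m → On (λ e → ⟦ e ⟧ x₀) (coeff v) M m →
      ∃ λ x → Sat L x × AgreeOff vs (x₀ [ v ↦ m + x₀ v ]) x
    lift-to m on = eliminateAll-sound vs L (x₀ [ v ↦ m + x₀ v ])
      (Equivalence.from (Sat-shift M x₀ v (m + x₀ v))
        (subst (On (λ e → ⟦ e ⟧ x₀) (coeff v) M) (solve 2 (λ m o → m := m :+ o :- o) refl m (x₀ v)) on))
    attain : ∃ (IsMin (λ e → ⟦ e ⟧ x₀) (coeff v) M (0ℚ - x₀ v)) → ∃ (Minimiser L vs v x₀)
    attain (m , _ , on , least) = conclude (lift-to m on)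
      where
      below : ∀ y → Sat L y → AgreeOff (v ∷ vs) x₀ y → m + x₀ v ≤ y v
      below y saty agree = subst (m + x₀ v ≤_) (solve 2 (λ y o → y :- o :+ o := y) refl (y v) (x₀ v))
        (+-monoˡ-≤ (x₀ v) (least (y v - x₀ v) (+-monoˡ-≤ (- x₀ v) (bounded y saty)) (onLine y saty agree)))
      conclude : (∃ λ x → Sat L x × AgreeOff vs (x₀ [ v ↦ m + x₀ v ]) x) → ∃ (Minimiser L vs v x₀)
      conclude (x , satx , agree) = x , satx , agree-update⁻ v (m + x₀ v) agree ,
        λ y saty agree-y → subst (_≤ y v) (trans (sym (update-same x₀ v (m + x₀ v))) (agree v∉))
          (below y saty agree-y)

  -- Predicates given by finitely many linear inequalities

  record Polyhedral (P : Point → Set) : Set where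
    field
      constraints : List Expr
      sound       : ∀ x → Sat constraints x → P x
      complete    : ∀ x → P x → Sat constraints x

  open Polyhedral public

  polyhedral-≤ : ∀ e f → Polyhedral (λ x → ⟦ e ⟧ x ≤ ⟦ f ⟧ x)
  polyhedral-≤ e f = record
    { constraints = (f ⊕ (- 1ℚ) ⊛ e) ∷ []
    ; sound       = λ x sat → 0≤q-p⇒p≤q (subst (0ℚ ≤_) (-1* x) (sat (here refl)))
    ; complete    = λ { x e≤f (here refl) → subst (0ℚ ≤_) (sym (-1* x)) (p≤q⇒0≤q-p e≤f) }
    }
    where
    -1* : ∀ x → ⟦ f ⊕ (- 1ℚ) ⊛ e ⟧ x ≡ ⟦ f ⟧ x - ⟦ e ⟧ x
    -1* x = solve 2 (λ e f → f :+ con (- 1ℚ) :* e := f :- e) refl (⟦ e ⟧ x) (⟦ f ⟧ x)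

  polyhedral-× : ∀ {P Q} → Polyhedral P → Polyhedral Q → Polyhedral (λ x → P x × Q x)
  polyhedral-× p q = record
    { constraints = constraints p ++ constraints q
    ; sound       = λ x sat → sound p x (λ {e} e∈ → sat {e} (∈-++⁺ˡ e∈)) ,
                              sound q x (λ {e} e∈ → sat {e} (∈-++⁺ʳ (constraints p) e∈))
    ; complete    = λ { x (px , qx) {e} e∈ →
                        [ complete p x px {e} , complete q x qx {e} ]′ (∈-++⁻ (constraints p) e∈) }
    }

  polyhedral-map : ∀ {P Q : Point → Set} → (∀ x → P x → Q x) → (∀ x → Q x → P x) → Polyhedral P → Polyhedral Q
  polyhedral-map P⇒Q Q⇒P p = record
    { constraints = constraints p
    ; sound       = λ x sat → P⇒Q x (sound p x sat)
    ; complete    = λ x qx → complete p x (Q⇒P x qx)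
    }

  polyhedral-≡ : ∀ e f → Polyhedral (λ x → ⟦ e ⟧ x ≡ ⟦ f ⟧ x)
  polyhedral-≡ e f = polyhedral-map (λ { _ (e≤f , f≤e) → ≤-antisym e≤f f≤e })
    (λ _ e≡f → ≤-reflexive e≡f , ≤-reflexive (sym e≡f))
    (polyhedral-× (polyhedral-≤ e f) (polyhedral-≤ f e))

  polyhedral-∀ : ∀ {n} {P : Fin n → Point → Set} → (∀ i → Polyhedral (P i)) → Polyhedral (λ x → ∀ i → P i x)
  polyhedral-∀ {zero}  _ = record { constraints = [] ; sound = λ _ _ () ; complete = λ _ _ () }
  polyhedral-∀ {suc n} p = polyhedral-map
    (λ { _ (p₀ , _) zero → p₀ ; _ (_ , pₛ) (suc i) → pₛ i })
    (λ _ h → h zero , λ i → h (suc i))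
    (polyhedral-× (p zero) (polyhedral-∀ (λ i → p (suc i))))

  -- The condition `A` does not depend on the point, so deciding it once tells whether the
  -- constraints belong to the list. This is why betweenness has to be decidable.
  polyhedral-→ : ∀ {A : Set} {P} → Dec A → Polyhedral P → Polyhedral (λ x → A → P x)
  polyhedral-→ (yes a) p = polyhedral-map (λ _ px _ → px) (λ _ h → h a) p
  polyhedral-→ (no ¬a) _ = record { constraints = [] ; sound = λ _ _ a → contradiction a ¬a ; complete = λ _ _ () }

-- Betweenness in trees

_∈?_ : ∀ {n} (i : Fin n) vs → Dec (i ∈ vs)
_∈?_ = DecMembership._∈?_ Fin._≟_

module _ {n : ℕ} {R : Fin n → Fin n → Set} where

  start∈ : ∀ {i j vs} → Walk R i j vs → i ∈ vs
  start∈ here       = here refl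
  start∈ (step _ _) = here refl

  suffix : ∀ {i j k vs} → Walk R i j vs → Unique vs → k ∈ vs → ∃ λ us → Walk R k j us × Unique us
  suffix here         u       (here refl) = _ , here , u
  suffix (step r p)   u       (here refl) = _ , step r p , u
  suffix (step r p)   (_ ∷ u) (there k∈)  = suffix p u k∈

  -- Loop erasure: when the start recurs later, only the part from that recurrence on is kept.
  simple-walk : ∀ {i j vs} → Walk R i j vs → ∃ λ us → Walk R i j us × Unique us
  simple-walk here = _ , here , [] ∷ []
  simple-walk {i} (step r p) with us , q , u ← simple-walk p | i ∈? us
  ... | yes i∈ = suffix q u i∈
  ... | no  i∉ = _ , step r q , ¬Any⇒All¬ us i∉ ∷ u

  walk? : (∀ i j → Dec (R i j)) → ∀ i j vs → Dec (Walk R i j vs)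
  walk? R? i j [] = no λ ()
  walk? R? i j (a ∷ []) = map′ (λ { (refl , refl) → here }) (λ { here → refl , refl ; (step _ ()) })
    (i Fin.≟ a ×-dec j Fin.≟ a)
  walk? R? i j (a ∷ b ∷ vs) = map′ (λ { (refl , r , p) → step r p })
    -- The inner walk is split only to reveal that it starts at `b`.
    (λ { (step r p@here) → refl , r , p ; (step r p@(step _ _)) → refl , r , p })
    (i Fin.≟ a ×-dec R? i b ×-dec walk? R? b j (b ∷ vs))

-- Pigeonhole: `lookup` on a repetition-free list is an injection into `Fin n`. The bound makes the
-- search for simple walks finite.
unique⇒length≤ : ∀ {n} {vs : List (Fin n)} → Unique vs → length vs ℕ.≤ n
unique⇒length≤ {vs = vs} u = Fin.injective⇒≤ (λ {i} {j} → lookup-injective u i j)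
  where
  lookup-injective : ∀ {vs} → Unique vs → ∀ i j → lookup vs i ≡ lookup vs j → i ≡ j
  lookup-injective (_ ∷ _)  zero    zero    _  = refl
  lookup-injective (a ∷ _)  zero    (suc j) eq = contradiction (subst (_∈ _) (sym eq) (∈-lookup j)) (All¬⇒¬Any a)
  lookup-injective (a ∷ _)  (suc i) zero    eq = contradiction (subst (_∈ _) eq (∈-lookup i)) (All¬⇒¬Any a)
  lookup-injective (_ ∷ u)  (suc i) (suc j) eq = cong suc (lookup-injective u i j eq)

short-list? : ∀ {n} {P : List (Fin n) → Set} → Decidable P → ∀ m → Dec (∃ λ vs → length vs ℕ.≤ m × P vs)
short-list? P? zero = map′ (λ p → [] , z≤n , p) (λ { ([] , _ , p) → p }) (P? [])
short-list? P? (suc m) = map′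
  (λ { (inj₁ p) → [] , z≤n , p ; (inj₂ (a , vs , l , p)) → a ∷ vs , s≤s l , p })
  (λ { ([] , _ , p) → inj₁ p ; (a ∷ vs , s≤s l , p) → inj₂ (a , vs , l , p) })
  (P? [] ⊎-dec Fin.any? (λ a → short-list? (λ vs → P? (a ∷ vs)) m))

-- Adjacency is an arbitrary relation, but the tree axioms decide it. A simple walk from `i` to `j`
-- is trivial, a single edge, or so long that an edge between `i` and `j` would close a cycle.
adj? : ∀ {n} (U : Tree n) i j → Dec (Adj U i j)
adj? U i j with simple-walk (proj₂ (connected U i j))
... | _ , here , _ = no (irrefl U)
... | _ , step r here , _ = yes r
... | _ , p@(step _ (step _ q)) , u = no (acyclic U p u (s≤s (s≤s (1≤length q))) ∘ Tree.sym U)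
  where
  1≤length : ∀ {i j vs} → Walk (Adj U) i j vs → 1 ℕ.≤ length vs
  1≤length here       = s≤s z≤n
  1≤length (step _ _) = s≤s z≤n

between? : ∀ {n} (U : Tree n) k i j → Dec (Between U k i j)
between? {n} U k i j = map′ (map₂ proj₂) (λ { (vs , p , u , q) → vs , unique⇒length≤ u , p , u , q })
  (short-list? (λ vs → walk? (adj? U) i j vs ×-dec DecUnique.unique? Fin._≟_ vs ×-dec (k ∈? vs) ×-dec ¬? (k Fin.≟ i) ×-dec ¬? (k Fin.≟ j)) n)

-- Single extensions and betweenness

-- a₀ is the node into which w is contracted: the neighbour of a new leaf w (then
-- b₀ is immaterial), or one endpoint of the subdivided edge a₀ b₀.
record Extension {n : ℕ} (T : Tree n) (T′ : Tree (suc n)) : Set where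
  field
    ι          : Fin n → Fin (suc n)
    w          : Fin (suc n)
    a₀ b₀      : Fin n
    ι-inj      : ∀ {a b} → ι a ≡ ι b → a ≡ b
    ι≢w        : ∀ {a} → ι a ≢ w
    cover      : ∀ y → y ≡ w ⊎ ∃ λ a → ι a ≡ y
    lift-edge  : ∀ {i j} → Adj T i j → Adj T′ (ι i) (ι j) ⊎
                   (Adj T′ (ι i) w × Adj T′ w (ι j) × ((i ≡ a₀ × j ≡ b₀) ⊎ (i ≡ b₀ × j ≡ a₀)))
    drop-edge  : ∀ {i j} → Adj T′ (ι i) (ι j) → Adj T i j
    merge-edge : ∀ {i j} → Adj T′ (ι i) w → Adj T′ w (ι j) → i ≢ j → Adj T i j × (i ≡ a₀ ⊎ j ≡ a₀)

  -- The last clause is the invariant that keeps the lifted walk simple: `w` is inserted only when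
  -- both ends of the subdivided edge have been visited.
  LiftedWalk : Fin n → Fin n → List (Fin n) → Set
  LiftedWalk i j vs = ∃ λ us → Walk (Adj T′) (ι i) (ι j) us × Unique us ×
    (∀ {a} → a ∈ vs → ι a ∈ us) ×
    (∀ {y} → y ∈ us → y ≡ w ⊎ ∃ λ a → a ∈ vs × ι a ≡ y) ×
    (w ∈ us → a₀ ∈ vs × b₀ ∈ vs)

  lift-walk : ∀ {i j vs} → Walk (Adj T) i j vs → Unique vs → LiftedWalk i j vs
  lift-walk {i} here _ = ι i ∷ [] , here , [] ∷ [] ,
    (λ { (here refl) → here refl }) ,
    (λ { (here refl) → inj₂ (i , here refl , refl) }) ,
    λ { (here w≡) → contradiction (sym w≡) ι≢w }
  lift-walk {i} {j} (step {j = m} {vs = vs} r p) (i≢vs ∷ u) with lift-walk p u | lift-edge r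
  ... | us , q , uq , old , new , w∈ | inj₁ r′ =
    ι i ∷ us , step r′ q , ¬Any⇒All¬ us ιi∉ ∷ uq ,
    (λ { (here refl) → here refl ; (there a∈) → there (old a∈) }) ,
    (λ { (here refl) → inj₂ (i , here refl , refl)
       ; (there y∈) → [ inj₁ , (λ { (a , a∈ , eq) → inj₂ (a , there a∈ , eq) }) ]′ (new y∈) }) ,
    λ { (here w≡) → contradiction (sym w≡) ι≢w ; (there w∈us) → there (proj₁ (w∈ w∈us)) , there (proj₂ (w∈ w∈us)) }
    where
    ιi∉ : ι i ∉ us
    ιi∉ ιi∈ with new ιi∈
    ... | inj₁ eq = ι≢w eq
    ... | inj₂ (a , a∈ , eq) = All¬⇒¬Any i≢vs (subst (_∈ vs) (ι-inj eq) a∈)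
  ... | us , q , uq , old , new , w∈ | inj₂ (r₁ , r₂ , ends) =
    ι i ∷ w ∷ us , step r₁ (step r₂ q) , ¬Any⇒All¬ (w ∷ us) ιi∉ ∷ ¬Any⇒All¬ us w∉ ∷ uq ,
    (λ { (here refl) → here refl ; (there a∈) → there (there (old a∈)) }) ,
    (λ { (here refl) → inj₂ (i , here refl , refl)
       ; (there (here eq)) → inj₁ eq
       ; (there (there y∈)) → [ inj₁ , (λ { (a , a∈ , eq) → inj₂ (a , there a∈ , eq) }) ]′ (new y∈) }) ,
    λ _ → ends∈ ends
    where
    i∉ : i ∉ vs
    i∉ = All¬⇒¬Any i≢vs
    ιi∉ : ι i ∉ w ∷ us
    ιi∉ (here eq) = ι≢w eq
    ιi∉ (there ιi∈) with new ιi∈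
    ... | inj₁ eq = ι≢w eq
    ... | inj₂ (a , a∈ , eq) = i∉ (subst (_∈ vs) (ι-inj eq) a∈)
    -- A second visit to `w` would put both `a₀` and `b₀` on `vs`, yet `i` is one of them and is not
    -- on `vs`.
    w∉ : w ∉ us
    w∉ w∈us = [ (λ { (refl , _) → i∉ (proj₁ (w∈ w∈us)) }) , (λ { (refl , _) → i∉ (proj₂ (w∈ w∈us)) }) ]′ ends
    ends∈ : (i ≡ a₀ × m ≡ b₀) ⊎ (i ≡ b₀ × m ≡ a₀) → a₀ ∈ i ∷ vs × b₀ ∈ i ∷ vs
    ends∈ (inj₁ (refl , refl)) = here refl , there (start∈ p)
    ends∈ (inj₂ (refl , refl)) = there (start∈ p) , here refl

  DroppedWalk : Fin n → Fin n → List (Fin (suc n)) → Set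
  DroppedWalk i j us = ∃ λ vs → Walk (Adj T) i j vs × Unique vs ×
    (∀ {a} → a ∈ vs → ι a ∈ us) × (∀ {a} → ι a ∈ us → a ∈ vs) × (w ∈ us → a₀ ∈ vs)

  -- A passage through `w` joins two distinct old neighbours, and `merge-edge` replaces it by one
  -- edge with `a₀` as an endpoint. The ends are given by equations so that the recursion can run
  -- along arbitrary nodes of `T′`.
  drop-walk : ∀ {y z us} → Walk (Adj T′) y z us → Unique us → ∀ {i j} → ι i ≡ y → ι j ≡ z → DroppedWalk i j us
  drop-walk here _ {i} refl eq with refl ← ι-inj eq = i ∷ [] , here , [] ∷ [] ,
    (λ { (here refl) → here refl }) ,
    (λ { (here eq) → here (ι-inj eq) }) ,
    λ { (here w≡) → contradiction (sym w≡) ι≢w }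
  drop-walk (step {j = y} {vs = us} r p) (ιi≢ ∷ u) {i} refl refl with cover y
  ... | inj₂ (m , refl)
    with vs , q , uq , old , new , w∈ ← drop-walk p u refl refl =
    i ∷ vs , step (drop-edge r) q , ¬Any⇒All¬ vs (λ i∈ → All¬⇒¬Any ιi≢ (old i∈)) ∷ uq ,
    (λ { (here refl) → here refl ; (there a∈) → there (old a∈) }) ,
    (λ { (here eq) → here (ι-inj eq) ; (there a∈) → there (new a∈) }) ,
    λ { (here w≡) → contradiction (sym w≡) ι≢w ; (there w∈us) → there (w∈ w∈us) }
  drop-walk (step r here) _ refl eq | inj₁ y≡w = contradiction (trans eq y≡w) ι≢w
  drop-walk (step r (step {j = y} {vs = us} r′ p)) (ιi≢ ∷ _ ∷ u) {i} refl refl | inj₁ y≡w with cover y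
  ... | inj₁ y≡w′ = contradiction (subst (Adj T′ _) (trans y≡w′ (sym y≡w)) r′) (irrefl T′)
  ... | inj₂ (m , refl)
    with vs , q , uq , old , new , w∈ ← drop-walk p u refl refl =
    i ∷ vs , step (proj₁ merged) q , ¬Any⇒All¬ vs (λ i∈ → All¬⇒¬Any ιi≢ (there (old i∈))) ∷ uq ,
    (λ { (here refl) → here refl ; (there a∈) → there (there (old a∈)) }) ,
    (λ { (here eq) → here (ι-inj eq) ; (there (here eq)) → contradiction (trans eq y≡w) ι≢w ; (there (there a∈)) → there (new a∈) }) ,
    λ _ → [ (λ { refl → here refl }) , (λ { refl → there (start∈ q) }) ]′ (proj₂ merged)
    where
    merged : Adj T i m × (i ≡ a₀ ⊎ m ≡ a₀)
    merged = merge-edge (subst (Adj T′ _) y≡w r) (subst (λ y → Adj T′ y _) y≡w r′) λ { refl → All¬⇒¬Any ιi≢ (there (start∈ p)) }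

  lift-between : ∀ {k i j} → Between T k i j → Between T′ (ι k) (ι i) (ι j)
  lift-between (vs , p , u , k∈ , k≢i , k≢j) with us , q , uq , old , _ ← lift-walk p u =
    us , q , uq , old k∈ , k≢i ∘ ι-inj , k≢j ∘ ι-inj

  drop-between : ∀ {k i j} → Between T′ (ι k) (ι i) (ι j) → Between T k i j
  drop-between (us , p , u , k∈ , k≢i , k≢j) with vs , q , uq , _ , new , _ ← drop-walk p u refl refl =
    vs , q , uq , new k∈ , k≢i ∘ cong ι , k≢j ∘ cong ι

  contract-between : ∀ {i j} → a₀ ≢ i → a₀ ≢ j → Between T′ w (ι i) (ι j) → Between T a₀ i j
  contract-between a₀≢i a₀≢j (us , p , u , w∈us , _) with vs , q , uq , _ , _ , w∈ ← drop-walk p u refl refl =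
    vs , q , uq , w∈ w∈us , a₀≢i , a₀≢j

extension : ∀ {n} {T : Tree n} {T′ : Tree (suc n)} → SingleExt T T′ → Extension T T′
extension {T = T} {T′} (leaf ι w v inj ι≢w cover edge edge-w) = record
  { ι = ι ; w = w ; a₀ = v ; b₀ = v ; ι-inj = inj _ _ ; ι≢w = ι≢w _ ; cover = cover
  ; lift-edge  = λ r → inj₁ (Equivalence.from (edge _ _) r)
  ; drop-edge  = Equivalence.to (edge _ _)
  -- A leaf has only one neighbour, so no walk passes through it between distinct nodes.
  ; merge-edge = λ r r′ i≢j → contradiction
      (trans (Equivalence.to (edge-w _) (Tree.sym T′ r)) (sym (Equivalence.to (edge-w _) r′))) i≢j
  }
extension {T = T} {T′} (subdivide ι w a₀ b₀ a₀b₀ inj ι≢w cover edge edge-w) = record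
  { ι = ι ; w = w ; a₀ = a₀ ; b₀ = b₀ ; ι-inj = inj _ _ ; ι≢w = ι≢w _ ; cover = cover
  ; lift-edge  = lift
  ; drop-edge  = proj₁ ∘ Equivalence.to (edge _ _)
  ; merge-edge = λ r r′ → merge (Equivalence.to (edge-w _) (Tree.sym T′ r)) (Equivalence.to (edge-w _) r′)
  }
  where
  Ends : Fin _ → Fin _ → Set
  Ends i j = (i ≡ a₀ × j ≡ b₀) ⊎ (i ≡ b₀ × j ≡ a₀)
  w~ : ∀ {i} → i ≡ a₀ ⊎ i ≡ b₀ → Adj T′ w (ι i)
  w~ = Equivalence.from (edge-w _)
  lift : ∀ {i j} → Adj T i j → Adj T′ (ι i) (ι j) ⊎ (Adj T′ (ι i) w × Adj T′ w (ι j) × Ends i j)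
  lift {i} {j} r with (i Fin.≟ a₀ ×-dec j Fin.≟ b₀) ⊎-dec (i Fin.≟ b₀ ×-dec j Fin.≟ a₀)
  ... | no  ¬ends = inj₁ (Equivalence.from (edge i j) (r , ¬ends))
  ... | yes ends@(inj₁ (i≡a , j≡b)) = inj₂ (Tree.sym T′ (w~ (inj₁ i≡a)) , w~ (inj₂ j≡b) , ends)
  ... | yes ends@(inj₂ (i≡b , j≡a)) = inj₂ (Tree.sym T′ (w~ (inj₂ i≡b)) , w~ (inj₁ j≡a) , ends)
  merge : ∀ {i j} → i ≡ a₀ ⊎ i ≡ b₀ → j ≡ a₀ ⊎ j ≡ b₀ → i ≢ j → Adj T i j × (i ≡ a₀ ⊎ j ≡ a₀)
  merge (inj₁ refl) (inj₁ refl) i≢j = contradiction refl i≢j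
  merge (inj₁ refl) (inj₂ refl) _   = a₀b₀ , inj₁ refl
  merge (inj₂ refl) (inj₁ refl) _   = Tree.sym T a₀b₀ , inj₂ refl
  merge (inj₂ refl) (inj₂ refl) i≢j = contradiction refl i≢j

-- Finite sums and convex combinations

module ℚSum = CommutativeMonoidSum ℚ.+-0-commutativeMonoid

∑≡sum : ∀ {n} (f : Fin n → ℚ) → ∑ f ≡ ℚSum.sum f
∑≡sum {zero}  f = refl
∑≡sum {suc n} f = cong (f zero +_) (∑≡sum (f ∘ suc))

∑-+ : ∀ {n} (f g : Fin n → ℚ) → ∑ (λ i → f i + g i) ≡ ∑ f + ∑ g
∑-+ f g = trans (∑≡sum (λ i → f i + g i)) (trans (ℚSum.∑-distrib-+ f g) (sym (cong₂ _+_ (∑≡sum f) (∑≡sum g))))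

∑-zero : ∀ {n} {f : Fin n → ℚ} → (∀ i → f i ≡ 0ℚ) → ∑ f ≡ 0ℚ
∑-zero {n} f≗0 = trans (∑-cong f≗0) (trans (∑≡sum {n} (λ _ → 0ℚ)) (ℚSum.sum-replicate-zero n))

∑-nonneg : ∀ {n} {f : Fin n → ℚ} → (∀ i → 0ℚ ≤ f i) → 0ℚ ≤ ∑ f
∑-nonneg {zero}  h = ≤-refl
∑-nonneg {suc n} h = 0≤p∧0≤q⇒0≤p+q (h zero) (∑-nonneg (h ∘ suc))

∑-mono : ∀ {n} {f g : Fin n → ℚ} → (∀ i → f i ≤ g i) → ∑ f ≤ ∑ g
∑-mono {zero}  h = ≤-refl
∑-mono {suc n} h = +-mono-≤ (h zero) (∑-mono (h ∘ suc))

∑-indicator : ∀ {n} (k : Fin n) q → ∑ (λ i → if does (i Fin.≟ k) then q else 0ℚ) ≡ q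
∑-indicator {suc n} zero    q = trans (cong (q +_) (∑-zero {n} (λ _ → refl))) (+-identityʳ q)
∑-indicator {suc n} (suc k) q = trans (+-identityˡ _) (∑-indicator k q)

-- Both `ι` and `punchIn w` enumerate the nodes other than `w`, hence they differ by a permutation,
-- under which the sum is invariant.
∑-split : ∀ {n} (ι : Fin n → Fin (suc n)) w → (∀ {a b} → ι a ≡ ι b → a ≡ b) → (∀ {a} → ι a ≢ w) →
  (∀ y → y ≡ w ⊎ ∃ λ a → ι a ≡ y) → ∀ f → ∑ f ≡ f w + ∑ (f ∘ ι)
∑-split {n} ι w ι-inj ι≢w cover f = begin
  ∑ f                                                ≡⟨ ∑≡sum f ⟩
  ℚSum.sum f                                         ≡⟨ ℚSum.sum-remove {i = w} f ⟩
  f w + ℚSum.sum (f ∘ punchIn w)                     ≡⟨ cong (f w +_) (ℚSum.sum-permute (f ∘ punchIn w) π) ⟩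
  f w + ℚSum.sum (λ a → f (punchIn w (to a)))        ≡⟨ cong (f w +_) (∑≡sum (λ a → f (punchIn w (to a)))) ⟨
  f w + ∑ (λ a → f (punchIn w (to a)))               ≡⟨ cong (f w +_) (∑-cong (λ a → cong f (punch-to a))) ⟩
  f w + ∑ (f ∘ ι)                                    ∎
  where
  open ≡.≡-Reasoning
  to : Fin n → Fin n
  to a = punchOut {i = w} {ι a} (ι≢w ∘ sym)
  punch-to : ∀ a → punchIn w (to a) ≡ ι a
  punch-to a = Fin.punchIn-punchOut (ι≢w ∘ sym)
  old : ∀ b → ∃ λ a → ι a ≡ punchIn w b
  old b = [ (λ eq → contradiction eq (Fin.punchInᵢ≢i w b)) , (λ o → o) ]′ (cover (punchIn w b))
  π : Permutation n n
  π = permutation to (proj₁ ∘ old)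
    (λ b → Fin.punchIn-injective w _ _ (trans (punch-to (proj₁ (old b))) (proj₂ (old b))))
    (λ a → ι-inj (trans (proj₂ (old (to a))) (punch-to a)))

sum≥₁ : ∀ {s p q r} → s ≤ p → 0ℚ ≤ q → 0ℚ ≤ r → s ≤ p + q + r
sum≥₁ {s} {p} {q} {r} s≤p 0≤q 0≤r = subst (_≤ p + q + r)
  (trans (+-identityʳ (s + 0ℚ)) (+-identityʳ s)) (+-mono-≤ (+-mono-≤ s≤p 0≤q) 0≤r)

sum≥₂ : ∀ {s p q r} → 0ℚ ≤ p → s ≤ q → 0ℚ ≤ r → s ≤ p + q + r
sum≥₂ {s} {p} {q} {r} 0≤p s≤q 0≤r = subst (_≤ p + q + r)
  (trans (+-identityʳ (0ℚ + s)) (+-identityˡ s)) (+-mono-≤ (+-mono-≤ 0≤p s≤q) 0≤r)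

sum≥₃ : ∀ {s p q r} → 0ℚ ≤ p → 0ℚ ≤ q → s ≤ r → s ≤ p + q + r
sum≥₃ {s} {p} {q} {r} 0≤p 0≤q s≤r = subst (_≤ p + q + r)
  (+-identityˡ s) (+-mono-≤ (+-mono-≤ 0≤p 0≤q) s≤r)

0<1-p : ∀ {p} → p < 1ℚ → 0ℚ < 1ℚ - p
0<1-p {p} p<1 = subst (_< 1ℚ - p) (+-inverseʳ p) (+-monoˡ-< (- p) p<1)

convex-idem : ∀ t p → t * p + (1ℚ - t) * p ≡ p
convex-idem = solve 2 (λ t p → t :* p :+ (con 1ℚ :- t) :* p := p) refl

-- A proper average of two numbers above `l` equals `l` only if both do: replacing `q` by `l` gives
-- `t * p ≤ t * l`, and `t` cancels.
convex-lowerˡ : ∀ {t l p q} → 0ℚ < t → t < 1ℚ → l ≤ p → l ≤ q → l ≡ t * p + (1ℚ - t) * q → p ≡ l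
convex-lowerˡ {t} {l} {p} {q} 0<t t<1 l≤p l≤q eq = ≤-antisym (*-cancelˡ-≤-pos t {{ℚ.positive 0<t}} (begin
  t * p                                          ≡⟨ solve 3 (λ t p q → t :* p := (t :* p :+ (con 1ℚ :- t) :* q) :- (con 1ℚ :- t) :* q) refl t p q ⟩
  (t * p + (1ℚ - t) * q) - (1ℚ - t) * q          ≡⟨ cong (_- (1ℚ - t) * q) eq ⟨
  l - (1ℚ - t) * q                               ≤⟨ +-monoʳ-≤ l (neg-antimono-≤ (0≤⇒*-monoˡ-≤ (<⇒≤ (0<1-p t<1)) l≤q)) ⟩
  l - (1ℚ - t) * l                               ≡⟨ solve 2 (λ t l → l :- (con 1ℚ :- t) :* l := t :* l) refl t l ⟩
  t * l                                          ∎)) l≤p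
  where open ≤-Reasoning

convex-lower : ∀ {t l p q} → 0ℚ < t → t < 1ℚ → l ≤ p → l ≤ q → l ≡ t * p + (1ℚ - t) * q → p ≡ l × q ≡ l
convex-lower {t} {l} {p} {q} 0<t t<1 l≤p l≤q eq =
  convex-lowerˡ 0<t t<1 l≤p l≤q eq ,
  convex-lowerˡ (0<1-p t<1) 1-t<1 l≤q l≤p
    (trans eq (solve 3 (λ t p q → t :* p :+ (con 1ℚ :- t) :* q := (con 1ℚ :- t) :* q :+ (con 1ℚ :- (con 1ℚ :- t)) :* p) refl t p q))
  where
  1-t<1 : 1ℚ - t < 1ℚ
  1-t<1 = subst (1ℚ - t <_) (+-identityʳ 1ℚ) (+-monoʳ-< 1ℚ (neg-antimono-< 0<t))

-- The STT polyhedron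

_≟_ : ∀ {n} → DecidableEquality (Coord n)
D i     ≟ D i′       = map′ (cong D) (λ { refl → refl }) (i Fin.≟ i′)
X i j   ≟ X i′ j′    = map′ (λ { (refl , refl) → refl }) (λ { refl → refl , refl }) (i Fin.≟ i′ ×-dec j Fin.≟ j′)
Z k i j ≟ Z k′ i′ j′ = map′ (λ { (refl , refl , refl) → refl }) (λ { refl → refl , refl , refl })
                         (k Fin.≟ k′ ×-dec i Fin.≟ i′ ×-dec j Fin.≟ j′)
D _     ≟ X _ _   = no λ ()
D _     ≟ Z _ _ _ = no λ ()
X _ _   ≟ D _     = no λ ()
X _ _   ≟ Z _ _ _ = no λ ()
Z _ _ _ ≟ D _     = no λ ()
Z _ _ _ ≟ X _ _   = no λ ()

module LinearSystem {n : ℕ} = FourierMotzkin (_≟_ {n})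
open LinearSystem

STT-polyhedral : ∀ {n} (U : Tree n) → Polyhedral (STT U)
STT-polyhedral U =
  polyhedral-× (polyhedral-∀ λ i → polyhedral-∀ λ j → polyhedral-→ (¬? (i Fin.≟ j)) (polyhedral-≤ zeroE (var (X i j)))) (
  polyhedral-× (polyhedral-∀ λ i → polyhedral-≡ (var (X i i)) zeroE) (
  polyhedral-× (∀kij λ k i j → polyhedral-→ (¬? (between? U k i j)) (polyhedral-≡ (var (Z k i j)) zeroE)) (
  polyhedral-× (∀kij λ k i j → polyhedral-→ (between? U k i j) (polyhedral-≤ zeroE (var (Z k i j)))) (
  polyhedral-× (∀kij λ k i j → polyhedral-→ (between? U k i j) (polyhedral-≡ (var (Z k i j)) (var (Z k j i)))) (
  polyhedral-× (polyhedral-∀ λ i → polyhedral-∀ λ j → polyhedral-→ (¬? (i Fin.≟ j))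
    (polyhedral-≤ (const 1ℚ) (var (X i j) ⊕ var (X j i) ⊕ sum (λ k → var (Z k i j))))) (
  polyhedral-× (∀kij λ k i j → polyhedral-→ (between? U k i j) (polyhedral-≤ (var (Z k i j)) (var (X k i)))) (
  polyhedral-× (∀kij λ k i j → polyhedral-→ (between? U k i j) (polyhedral-≤ (var (Z k i j)) (var (X k j))))
  (polyhedral-∀ λ i → polyhedral-≤ (sum (λ j → var (X j i))) (var (D i))))))))))
  where
  zeroE : ∀ {n} → Expr {n}
  zeroE = const 0ℚ
  ∀kij : ∀ {n} {P : Fin n → Fin n → Fin n → (Coord n → ℚ) → Set} → (∀ k i j → Polyhedral (P k i j)) →
    Polyhedral (λ x → ∀ k i j → P k i j x)
  ∀kij p = polyhedral-∀ λ k → polyhedral-∀ λ i → polyhedral-∀ λ j → p k i j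

nonDepth : ∀ n → List (Coord n)
nonDepth n = cartesianProductWith X (allFin n) (allFin n)
  ++ cartesianProductWith (λ k → uncurry (Z k)) (allFin n) (cartesianProduct (allFin n) (allFin n))

D∉nonDepth : ∀ {n} i → D i ∉ nonDepth n
D∉nonDepth {n} i D∈ with ∈-++⁻ (cartesianProductWith X (allFin n) (allFin n)) D∈
... | inj₁ D∈X with _ , _ , _ , _ , () ← ∈-cartesianProductWith⁻ X (allFin n) (allFin n) D∈X
... | inj₂ D∈Z with _ , _ , _ , _ , () ← ∈-cartesianProductWith⁻ (λ k → uncurry (Z k)) (allFin n) (cartesianProduct (allFin n) (allFin n)) D∈Z

∉nonDepth⇒D : ∀ {n} {c : Coord n} → c ∉ nonDepth n → ∃ λ i → c ≡ D i
∉nonDepth⇒D {c = D i}     _  = i , refl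
∉nonDepth⇒D {c = X i j}   c∉ = contradiction (∈-++⁺ˡ (∈-cartesianProductWith⁺ X (∈-allFin i) (∈-allFin j))) c∉
∉nonDepth⇒D {n} {c = Z k i j} c∉ = contradiction (∈-++⁺ʳ (cartesianProductWith X (allFin n) (allFin n))
  (∈-cartesianProductWith⁺ (λ k → uncurry (Z k)) (∈-allFin k) (∈-cartesianProduct⁺ (∈-allFin i) (∈-allFin j)))) c∉

-- A form of `STT` with fewer side conditions: the coordinates pinned to 0 also satisfy the sign,
-- symmetry and `Z` versus `X` constraints, so these hold for all indices.
record Feasible {n : ℕ} (U : Tree n) (x : Coord n → ℚ) : Set where
  field
    X≥0    : ∀ i j → 0ℚ ≤ x (X i j)
    X-diag : ∀ i → x (X i i) ≡ 0ℚ
    Z-out  : ∀ k i j → ¬ Between U k i j → x (Z k i j) ≡ 0ℚ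
    Z≥0    : ∀ k i j → 0ℚ ≤ x (Z k i j)
    Z-sym  : ∀ k i j → x (Z k i j) ≡ x (Z k j i)
    covers : ∀ i j → i ≢ j → 1ℚ ≤ x (X i j) + x (X j i) + ∑ (λ k → x (Z k i j))
    Z≤Xˡ   : ∀ k i j → x (Z k i j) ≤ x (X k i)
    Z≤Xʳ   : ∀ k i j → x (Z k i j) ≤ x (X k j)
    depth  : ∀ i → ∑ (λ j → x (X j i)) ≤ x (D i)

  D≥0 : ∀ i → 0ℚ ≤ x (D i)
  D≥0 i = ≤-trans (∑-nonneg (λ j → X≥0 j i)) (depth i)

feasible⇒STT : ∀ {n} {U : Tree n} {x} → Feasible U x → STT U x
feasible⇒STT F = (λ i j _ → X≥0 i j) , X-diag , Z-out , (λ k i j _ → Z≥0 k i j) , (λ k i j _ → Z-sym k i j) ,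
  covers , (λ k i j _ → Z≤Xˡ k i j) , (λ k i j _ → Z≤Xʳ k i j) , depth
  where open Feasible F

STT⇒feasible : ∀ {n} {U : Tree n} {x} → STT U x → Feasible U x
STT⇒feasible {n} {U} {x} (x≥0 , x-diag , z-out , z≥0 , z-sym , cov , z≤xˡ , z≤xʳ , dep) = record
  { X≥0 = X≥0 ; X-diag = x-diag ; Z-out = z-out ; Z≥0 = Z≥0 ; Z-sym = Z-sym ; covers = cov
  ; Z≤Xˡ = Z≤Xˡ ; Z≤Xʳ = Z≤Xʳ ; depth = dep }
  where
  X≥0 : ∀ i j → 0ℚ ≤ x (X i j)
  X≥0 i j with i Fin.≟ j
  ... | yes refl = ≤-reflexive (sym (x-diag i))
  ... | no  i≢j  = x≥0 i j i≢j
  Z≥0 : ∀ k i j → 0ℚ ≤ x (Z k i j)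
  Z≥0 k i j with between? U k i j
  ... | yes b = z≥0 k i j b
  ... | no ¬b = ≤-reflexive (sym (z-out k i j ¬b))
  Z-sym : ∀ k i j → x (Z k i j) ≡ x (Z k j i)
  Z-sym k i j with between? U k i j | between? U k j i
  ... | yes b | _      = z-sym k i j b
  ... | no _  | yes b  = sym (z-sym k j i b)
  ... | no ¬b | no ¬b′ = trans (z-out k i j ¬b) (sym (z-out k j i ¬b′))
  Z≤Xˡ : ∀ k i j → x (Z k i j) ≤ x (X k i)
  Z≤Xˡ k i j with between? U k i j
  ... | yes b = z≤xˡ k i j b
  ... | no ¬b = subst (_≤ x (X k i)) (sym (z-out k i j ¬b)) (X≥0 k i)
  Z≤Xʳ : ∀ k i j → x (Z k i j) ≤ x (X k j)
  Z≤Xʳ k i j with between? U k i j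
  ... | yes b = z≤xʳ k i j b
  ... | no ¬b = subst (_≤ x (X k j)) (sym (z-out k i j ¬b)) (X≥0 k j)

-- Extending and contracting feasible points

module ExtendAndContract {n : ℕ} {U : Tree n} {U′ : Tree (suc n)} (ext : Extension U U′) where
  open Extension ext

  ∑-nodes : ∀ f → ∑ f ≡ f w + ∑ (f ∘ ι)
  ∑-nodes = ∑-split ι w ι-inj ι≢w cover

  ∑-nodes-0 : ∀ f {g : Fin n → ℚ} → f w ≡ 0ℚ → (∀ a → f (ι a) ≡ g a) → ∑ f ≡ ∑ g
  ∑-nodes-0 f {g} fw≡0 f≗g = trans (∑-nodes f) (trans (cong₂ _+_ fw≡0 (∑-cong f≗g)) (+-identityˡ (∑ g)))

  by-node : (P : Fin (suc n) → Set) → P w → (∀ a → P (ι a)) → ∀ y → P y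
  by-node P Pw Pι y = [ (λ { refl → Pw }) , (λ { (a , refl) → Pι a }) ]′ (cover y)

  ι-coord : Coord n → Coord (suc n)
  ι-coord (D a)     = D (ι a)
  ι-coord (X a b)   = X (ι a) (ι b)
  ι-coord (Z k a b) = Z (ι k) (ι a) (ι b)

  -- With `nothing` standing for the new node, a point of the larger LP can be defined by pattern
  -- matching.
  old : Fin (suc n) → Maybe (Fin n)
  old y = [ (λ _ → nothing) , (λ { (a , _) → just a }) ]′ (cover y)

  old-w : old w ≡ nothing
  old-w with cover w
  ... | inj₁ _        = refl
  ... | inj₂ (a , eq) = contradiction eq ι≢w

  old-ι : ∀ a → old (ι a) ≡ just a
  old-ι a with cover (ι a)
  ... | inj₁ eq       = contradiction eq ι≢w
  ... | inj₂ (b , eq) = cong just (ι-inj eq)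

  -- bottom x makes the new node a descendant of every old node.
  module _ (x : Coord n → ℚ) where

    bottomD : Maybe (Fin n) → ℚ
    bottomD (just a) = x (D a)
    -- The number of old nodes, each of which is an ancestor of `w`; as a sum it matches the depth
    -- constraint term by term.
    bottomD nothing  = ∑ {n} (λ _ → 1ℚ)

    bottomX : Maybe (Fin n) → Maybe (Fin n) → ℚ
    bottomX (just a) (just b) = x (X a b)
    bottomX (just _) nothing  = 1ℚ
    bottomX nothing  _        = 0ℚ

    bottomZ : Maybe (Fin n) → Maybe (Fin n) → Maybe (Fin n) → ℚ
    bottomZ (just k) (just a) (just b) = x (Z k a b)
    bottomZ (just _) (just _) nothing  = 0ℚ
    bottomZ (just _) nothing  _        = 0ℚ
    bottomZ nothing  _        _        = 0ℚ

    bottom : Coord (suc n) → ℚ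
    bottom (D y)     = bottomD (old y)
    bottom (X y z)   = bottomX (old y) (old z)
    bottom (Z k y z) = bottomZ (old k) (old y) (old z)

    bottom-ι : ∀ c → bottom (ι-coord c) ≡ x c
    bottom-ι (D a)     = cong bottomD (old-ι a)
    bottom-ι (X a b)   = cong₂ bottomX (old-ι a) (old-ι b)
    bottom-ι (Z k a b) = trans (cong₂ (bottomZ (old (ι k))) (old-ι a) (old-ι b))
                               (cong (λ k → bottomZ k (just a) (just b)) (old-ι k))

    bottom-Dw : bottom (D w) ≡ ∑ {n} (λ _ → 1ℚ)
    bottom-Dw = cong bottomD old-w

    bottom-Xιw : ∀ a → bottom (X (ι a) w) ≡ 1ℚ
    bottom-Xιw a = cong₂ bottomX (old-ι a) old-w

    bottom-Xw : ∀ y → bottom (X w y) ≡ 0ℚ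
    bottom-Xw y = cong (λ v → bottomX v (old y)) old-w

    bottom-Zw : ∀ y z → bottom (Z w y z) ≡ 0ℚ
    bottom-Zw y z = cong (λ v → bottomZ v (old y) (old z)) old-w

    bottom-Z·w : ∀ k z → bottom (Z k w z) ≡ 0ℚ
    bottom-Z·w k z = trans (cong (λ v → bottomZ (old k) v (old z)) old-w) (lemma (old k))
      where
      lemma : ∀ k → bottomZ k nothing (old z) ≡ 0ℚ
      lemma (just _) = refl
      lemma nothing  = refl

    bottom-Z··w : ∀ k y → bottom (Z k y w) ≡ 0ℚ
    bottom-Z··w k y = trans (cong (bottomZ (old k) (old y)) old-w) (lemma (old k) (old y))
      where
      lemma : ∀ k y → bottomZ k y nothing ≡ 0ℚ
      lemma (just _) (just _) = refl
      lemma (just _) nothing  = refl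
      lemma nothing  _        = refl

    bottom-feasible : Feasible U x → Feasible U′ bottom
    bottom-feasible F = record
      { X≥0 = X≥0′ ; X-diag = diag ; Z-out = out ; Z≥0 = Z≥0′ ; Z-sym = sym′
      ; covers = covers′ ; Z≤Xˡ = Z≤Xˡ′ ; Z≤Xʳ = Z≤Xʳ′ ; depth = depth′ }
      where
      open Feasible F
      zero≤ : ∀ {p q} → p ≡ 0ℚ → 0ℚ ≤ q → p ≤ q
      zero≤ refl 0≤q = 0≤q
      nonneg : ∀ {p} → p ≡ 0ℚ → 0ℚ ≤ p
      nonneg eq = ≤-reflexive (sym eq)
      X≥0′ : ∀ y z → 0ℚ ≤ bottom (X y z)
      X≥0′ = by-node _ (λ z → nonneg (bottom-Xw z)) (λ a → by-node _
        (subst (0ℚ ≤_) (sym (bottom-Xιw a)) (<⇒≤ (positive⁻¹ 1ℚ)))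
        (λ b → subst (0ℚ ≤_) (sym (bottom-ι (X a b))) (X≥0 a b)))
      diag : ∀ y → bottom (X y y) ≡ 0ℚ
      diag = by-node _ (bottom-Xw w) (λ a → trans (bottom-ι (X a a)) (X-diag a))
      -- Any `Z` coordinate with an index `w` vanishes together with its mirror image, so only
      -- triples of old nodes need an argument.
      by-Z : (P : Fin (suc n) → Fin (suc n) → Fin (suc n) → Set) →
        (∀ k y z → bottom (Z k y z) ≡ 0ℚ → bottom (Z k z y) ≡ 0ℚ → P k y z) →
        (∀ k a b → P (ι k) (ι a) (ι b)) → ∀ k y z → P k y z
      by-Z P P0 Pι = by-node _ (λ y z → P0 w y z (bottom-Zw y z) (bottom-Zw z y))
        (λ k → by-node _ (λ z → P0 (ι k) w z (bottom-Z·w (ι k) z) (bottom-Z··w (ι k) z))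
        (λ a → by-node _ (P0 (ι k) (ι a) w (bottom-Z··w (ι k) (ι a)) (bottom-Z·w (ι k) (ι a)))
        (Pι k a)))
      out : ∀ k y z → ¬ Between U′ k y z → bottom (Z k y z) ≡ 0ℚ
      out = by-Z _ (λ k y z eq _ _ → eq)
        (λ k a b ¬b → trans (bottom-ι (Z k a b)) (Z-out k a b (¬b ∘ lift-between)))
      Z≥0′ : ∀ k y z → 0ℚ ≤ bottom (Z k y z)
      Z≥0′ = by-Z _ (λ k y z eq _ → nonneg eq) (λ k a b → subst (0ℚ ≤_) (sym (bottom-ι (Z k a b))) (Z≥0 k a b))
      sym′ : ∀ k y z → bottom (Z k y z) ≡ bottom (Z k z y)
      sym′ = by-Z _ (λ k y z eq eq′ → trans eq (sym eq′))
        (λ k a b → trans (bottom-ι (Z k a b)) (trans (Z-sym k a b) (sym (bottom-ι (Z k b a)))))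
      Z≤Xˡ′ : ∀ k y z → bottom (Z k y z) ≤ bottom (X k y)
      Z≤Xˡ′ = by-Z _ (λ k y z eq _ → zero≤ eq (X≥0′ k y))
        (λ k a b → subst₂ _≤_ (sym (bottom-ι (Z k a b))) (sym (bottom-ι (X k a))) (Z≤Xˡ k a b))
      Z≤Xʳ′ : ∀ k y z → bottom (Z k y z) ≤ bottom (X k z)
      Z≤Xʳ′ = by-Z _ (λ k y z eq _ → zero≤ eq (X≥0′ k z))
        (λ k a b → subst₂ _≤_ (sym (bottom-ι (Z k a b))) (sym (bottom-ι (X k b))) (Z≤Xʳ k a b))
      covers′ : ∀ y z → y ≢ z → 1ℚ ≤ bottom (X y z) + bottom (X z y) + ∑ (λ k → bottom (Z k y z))
      covers′ = by-node _
        (by-node _ (λ w≢w → contradiction refl w≢w)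
          (λ b _ → sum≥₂ (X≥0′ w (ι b)) (≤-reflexive (sym (bottom-Xιw b))) (∑-nonneg (λ k → Z≥0′ k w (ι b)))))
        (λ a → by-node _
          (λ _ → sum≥₁ (≤-reflexive (sym (bottom-Xιw a))) (X≥0′ w (ι a)) (∑-nonneg (λ k → Z≥0′ k (ι a) w)))
          (λ b a≢b → subst (1ℚ ≤_)
            (sym (cong₂ _+_ (cong₂ _+_ (bottom-ι (X a b)) (bottom-ι (X b a)))
              (∑-nodes-0 (λ k → bottom (Z k (ι a) (ι b))) (bottom-Zw (ι a) (ι b)) (λ k → bottom-ι (Z k a b)))))
            (covers a b (a≢b ∘ cong ι))))
      depth′ : ∀ y → ∑ (λ z → bottom (X z y)) ≤ bottom (D y)
      depth′ = by-node _
        (≤-reflexive (trans (∑-nodes-0 (λ z → bottom (X z w)) (bottom-Xw w) bottom-Xιw) (sym bottom-Dw)))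
        (λ a → subst₂ _≤_ (sym (∑-nodes-0 (λ z → bottom (X z (ι a))) (bottom-Xw (ι a)) (λ b → bottom-ι (X b a)))) (sym (bottom-ι (D a))) (depth a))

  -- contract y merges the new node into a₀: its rows X w and Z w are added to those of a₀.
  at-a₀ : Fin n → ℚ → ℚ
  at-a₀ k q = if does (k Fin.≟ a₀) then q else 0ℚ

  off-a₀ : Fin n → ℚ → ℚ
  off-a₀ a q = if does (a Fin.≟ a₀) then 0ℚ else q

  at-a₀-mono : ∀ k {p q} → p ≤ q → at-a₀ k p ≤ at-a₀ k q
  at-a₀-mono k p≤q with k Fin.≟ a₀
  ... | yes _ = p≤q
  ... | no  _ = ≤-refl

  at-a₀-zero : ∀ k → at-a₀ k 0ℚ ≡ 0ℚ
  at-a₀-zero k with k Fin.≟ a₀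
  ... | yes _ = refl
  ... | no  _ = refl

  off-a₀-mono : ∀ a {p q} → p ≤ q → off-a₀ a p ≤ off-a₀ a q
  off-a₀-mono a p≤q with a Fin.≟ a₀
  ... | yes _ = ≤-refl
  ... | no  _ = p≤q

  off-a₀-zero : ∀ a → off-a₀ a 0ℚ ≡ 0ℚ
  off-a₀-zero a with a Fin.≟ a₀
  ... | yes _ = refl
  ... | no  _ = refl

  off-a₀-≤ : ∀ a {q} → 0ℚ ≤ q → off-a₀ a q ≤ q
  off-a₀-≤ a 0≤q with a Fin.≟ a₀
  ... | yes _ = 0≤q
  ... | no  _ = ≤-refl

  at-a₀-yes : ∀ {k} q → k ≡ a₀ → at-a₀ k q ≡ q
  at-a₀-yes {k} q k≡a₀ with k Fin.≟ a₀
  ... | yes _ = refl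
  ... | no k≢a₀ = contradiction k≡a₀ k≢a₀

  off-a₀-no : ∀ {a} q → a ≢ a₀ → off-a₀ a q ≡ q
  off-a₀-no {a} q a≢a₀ with a Fin.≟ a₀
  ... | yes a≡a₀ = contradiction a≡a₀ a≢a₀
  ... | no _ = refl

  off-a₀-comm : ∀ a b q → off-a₀ a (off-a₀ b q) ≡ off-a₀ b (off-a₀ a q)
  off-a₀-comm a b q with a Fin.≟ a₀ | b Fin.≟ a₀
  ... | yes _ | yes _ = refl
  ... | yes _ | no  _ = refl
  ... | no  _ | yes _ = refl
  ... | no  _ | no  _ = refl

  at-a₀-nonneg : ∀ k {q} → 0ℚ ≤ q → 0ℚ ≤ at-a₀ k q
  at-a₀-nonneg k {q} 0≤q = subst (_≤ at-a₀ k q) (at-a₀-zero k) (at-a₀-mono k 0≤q)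

  off-a₀-nonneg : ∀ a {q} → 0ℚ ≤ q → 0ℚ ≤ off-a₀ a q
  off-a₀-nonneg a {q} 0≤q = subst (_≤ off-a₀ a q) (off-a₀-zero a) (off-a₀-mono a 0≤q)

  module _ (y : Coord (suc n) → ℚ) where

    -- The value of `X w (ι a₀)` is discarded, since merging would place it on the diagonal. In
    -- `gainZ` the terms with endpoint `a₀` are discarded likewise, because `a₀` is not strictly
    -- between itself and another node.
    gainX : Fin n → Fin n → ℚ
    gainX k a = at-a₀ k (off-a₀ a (y (X w (ι a))))

    gainZ : Fin n → Fin n → Fin n → ℚ
    gainZ k a b = at-a₀ k (off-a₀ a (off-a₀ b (y (Z w (ι a) (ι b)))))

    contract : Coord n → ℚ
    contract (D a)     = y (D (ι a))
    contract (X a b)   = y (X (ι a) (ι b)) + gainX a b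
    contract (Z k a b) = y (Z (ι k) (ι a) (ι b)) + gainZ k a b

    contract-ι : (∀ a → y (X w (ι a)) ≡ 0ℚ) → (∀ a b → y (Z w (ι a) (ι b)) ≡ 0ℚ) →
      ∀ c → contract c ≡ y (ι-coord c)
    contract-ι _   _   (D a)     = refl
    contract-ι Xw≡0 _  (X k a)   = trans (cong (y (X (ι k) (ι a)) +_) (trans
      (cong (λ q → at-a₀ k (off-a₀ a q)) (Xw≡0 a))
      (trans (cong (at-a₀ k) (off-a₀-zero a)) (at-a₀-zero k)))) (+-identityʳ _)
    contract-ι _ Zw≡0 (Z k a b) = trans (cong (y (Z (ι k) (ι a) (ι b)) +_) (trans
      (cong (λ q → at-a₀ k (off-a₀ a (off-a₀ b q))) (Zw≡0 a b))
      (trans (cong (λ q → at-a₀ k (off-a₀ a q)) (off-a₀-zero b))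
      (trans (cong (at-a₀ k) (off-a₀-zero a)) (at-a₀-zero k))))) (+-identityʳ _)

    -- Rows of `w` and `a₀` are added in `X` and `Z` alike, which preserves the bounds of `Z` by
    -- `X`. Discarding terms can only lower the depth sums; the covering constraints survive by
    -- `gain-bound`.
    contract-feasible : Feasible U′ y → Feasible U contract
    contract-feasible F = record
      { X≥0    = λ a b → 0≤p∧0≤q⇒0≤p+q (X≥0 (ι a) (ι b)) (gainX≥0 a b)
      ; X-diag = λ a → cong₂ _+_ (X-diag (ι a)) (gainX-diag a)
      ; Z-out  = λ k a b ¬b → cong₂ _+_ (Z-out (ι k) (ι a) (ι b) (¬b ∘ drop-between)) (gainZ-out k a b ¬b)
      ; Z≥0    = λ k a b → 0≤p∧0≤q⇒0≤p+q (Z≥0 (ι k) (ι a) (ι b)) (gainZ≥0 k a b)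
      ; Z-sym  = λ k a b → cong₂ _+_ (Z-sym (ι k) (ι a) (ι b)) (gainZ-sym k a b)
      ; covers = covers′
      ; Z≤Xˡ   = λ k a b → +-mono-≤ (Z≤Xˡ (ι k) (ι a) (ι b)) (at-a₀-mono k
                   (off-a₀-mono a (≤-trans (off-a₀-≤ b (Z≥0 w (ι a) (ι b))) (Z≤Xˡ w (ι a) (ι b)))))
      ; Z≤Xʳ   = λ k a b → +-mono-≤ (Z≤Xʳ (ι k) (ι a) (ι b)) (at-a₀-mono k
                   (≤-trans (off-a₀-≤ a (off-a₀-nonneg b (Z≥0 w (ι a) (ι b)))) (off-a₀-mono b (Z≤Xʳ w (ι a) (ι b)))))
      ; depth  = depth′
      }
      where
      open Feasible F
      gainX≥0 : ∀ k a → 0ℚ ≤ gainX k a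
      gainX≥0 k a = at-a₀-nonneg k (off-a₀-nonneg a (X≥0 w (ι a)))
      gainZ≥0 : ∀ k a b → 0ℚ ≤ gainZ k a b
      gainZ≥0 k a b = at-a₀-nonneg k (off-a₀-nonneg a (off-a₀-nonneg b (Z≥0 w (ι a) (ι b))))
      gainX-diag : ∀ a → gainX a a ≡ 0ℚ
      gainX-diag a with a Fin.≟ a₀
      ... | yes _ = refl
      ... | no  _ = refl
      gainZ-out : ∀ k a b → ¬ Between U k a b → gainZ k a b ≡ 0ℚ
      gainZ-out k a b ¬b with k Fin.≟ a₀ | a Fin.≟ a₀ | b Fin.≟ a₀
      ... | no _     | _       | _       = refl
      ... | yes _    | yes _   | _       = refl
      ... | yes _    | no _    | yes _   = refl
      -- The only case with a real gain: were `w` between the two nodes, `a₀` would be as well.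
      ... | yes refl | no a≢a₀ | no b≢a₀ = Z-out w (ι a) (ι b) (¬b ∘ contract-between (a≢a₀ ∘ sym) (b≢a₀ ∘ sym))
      gainZ-sym : ∀ k a b → gainZ k a b ≡ gainZ k b a
      gainZ-sym k a b = cong (at-a₀ k) (trans (off-a₀-comm a b (y (Z w (ι a) (ι b))))
        (cong (λ q → off-a₀ b (off-a₀ a q)) (Z-sym w (ι a) (ι b))))
      gain : ∀ a b → ℚ
      gain a b = gainX a b + gainX b a + ∑ (λ k → gainZ k a b)
      ∑gainZ : ∀ a b → ∑ (λ k → gainZ k a b) ≡ off-a₀ a (off-a₀ b (y (Z w (ι a) (ι b))))
      ∑gainZ a b = ∑-indicator a₀ (off-a₀ a (off-a₀ b (y (Z w (ι a) (ι b)))))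
      gainX-at : ∀ {a b} → a ≡ a₀ → b ≢ a₀ → gainX a b ≡ y (X w (ι b))
      gainX-at {a} {b} a≡ b≢ = trans (at-a₀-yes (off-a₀ b (y (X w (ι b)))) a≡) (off-a₀-no (y (X w (ι b))) b≢)
      -- The lost term `Z w` of a covering constraint reappears in full at `Z a₀` if neither
      -- endpoint is `a₀`. Otherwise the entry of `X w` at the other endpoint, which dominates it,
      -- has moved to the row of `a₀`.
      gain-bound : ∀ a b → a ≢ b → Dec (a ≡ a₀) → Dec (b ≡ a₀) → y (Z w (ι a) (ι b)) ≤ gain a b
      gain-bound a b a≢b (yes a≡) _ = sum≥₁
        (subst (y (Z w (ι a) (ι b)) ≤_) (sym (gainX-at a≡ (λ b≡ → a≢b (trans a≡ (sym b≡))))) (Z≤Xʳ w (ι a) (ι b)))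
        (gainX≥0 b a) (∑-nonneg (λ k → gainZ≥0 k a b))
      gain-bound a b a≢b (no a≢) (yes b≡) = sum≥₂ (gainX≥0 a b)
        (subst (y (Z w (ι a) (ι b)) ≤_) (sym (gainX-at b≡ a≢)) (Z≤Xˡ w (ι a) (ι b)))
        (∑-nonneg (λ k → gainZ≥0 k a b))
      gain-bound a b a≢b (no a≢) (no b≢) = sum≥₃ (gainX≥0 a b) (gainX≥0 b a)
        (≤-reflexive (sym (trans (∑gainZ a b) (trans (off-a₀-no (off-a₀ b (y (Z w (ι a) (ι b)))) a≢) (off-a₀-no (y (Z w (ι a) (ι b))) b≢)))))
      covers′ : ∀ a b → a ≢ b → 1ℚ ≤ contract (X a b) + contract (X b a) + ∑ (λ k → contract (Z k a b))
      covers′ a b a≢b = begin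
        1ℚ                                     ≤⟨ covers (ι a) (ι b) (a≢b ∘ ι-inj) ⟩
        p + q + ∑ (λ k → y (Z k (ι a) (ι b)))  ≡⟨ cong (p + q +_) (∑-nodes (λ k → y (Z k (ι a) (ι b)))) ⟩
        p + q + (s + r)                        ≤⟨ +-monoʳ-≤ (p + q) (+-monoˡ-≤ r (gain-bound a b a≢b (a Fin.≟ a₀) (b Fin.≟ a₀))) ⟩
        p + q + (gain a b + r)                 ≡⟨ solve 6 (λ p q r p′ q′ r′ → p :+ q :+ (p′ :+ q′ :+ r′ :+ r) := p :+ p′ :+ (q :+ q′) :+ (r :+ r′)) refl
                                                    p q r (gainX a b) (gainX b a) (∑ (λ k → gainZ k a b)) ⟩
        contract (X a b) + contract (X b a) + (r + ∑ (λ k → gainZ k a b))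
                                               ≡⟨ cong (contract (X a b) + contract (X b a) +_) (∑-+ (λ k → y (Z (ι k) (ι a) (ι b))) (λ k → gainZ k a b)) ⟨
        contract (X a b) + contract (X b a) + ∑ (λ k → contract (Z k a b)) ∎
        where
        open ≤-Reasoning
        p = y (X (ι a) (ι b))
        q = y (X (ι b) (ι a))
        s = y (Z w (ι a) (ι b))
        r = ∑ (λ k → y (Z (ι k) (ι a) (ι b)))
      depth′ : ∀ a → ∑ (λ b → contract (X b a)) ≤ y (D (ι a))
      depth′ a = begin
        ∑ (λ b → contract (X b a))                 ≡⟨ ∑-+ (λ b → y (X (ι b) (ι a))) (λ b → gainX b a) ⟩
        r + ∑ (λ b → gainX b a)                    ≡⟨ cong (r +_) (∑-indicator a₀ (off-a₀ a (y (X w (ι a))))) ⟩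
        r + off-a₀ a (y (X w (ι a)))               ≤⟨ +-monoʳ-≤ r (off-a₀-≤ a (X≥0 w (ι a))) ⟩
        r + y (X w (ι a))                          ≡⟨ +-comm r (y (X w (ι a))) ⟩
        y (X w (ι a)) + r                          ≡⟨ ∑-nodes (λ z → y (X z (ι a))) ⟨
        ∑ (λ z → y (X z (ι a)))                    ≤⟨ depth (ι a) ⟩
        y (D (ι a))                                ∎
        where
        open ≤-Reasoning
        r = ∑ (λ b → y (X (ι b) (ι a)))

  -- Vertices of the LP polyhedron

  covers-w : ∀ {y} (F : Feasible U′ y) → (∀ z → y (X w z) ≡ 0ℚ) → (∀ k z → y (Z k z w) ≡ 0ℚ) →
    ∀ a → 1ℚ ≤ y (X (ι a) w)
  covers-w {y} F Xw≡0 Zw≡0 a = subst (1ℚ ≤_)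
    (trans (cong₂ _+_ (trans (cong (y (X (ι a) w) +_) (Xw≡0 (ι a))) (+-identityʳ (y (X (ι a) w))))
                      (∑-zero (λ k → Zw≡0 k (ι a))))
           (+-identityʳ (y (X (ι a) w))))
    (Feasible.covers F (ι a) w ι≢w)

  depth-w : ∀ {y} (F : Feasible U′ y) → (∀ a → 1ℚ ≤ y (X (ι a) w)) → ∑ {n} (λ _ → 1ℚ) ≤ y (D w)
  depth-w {y} F 1≤X = begin
    ∑ {n} (λ _ → 1ℚ)                       ≤⟨ ∑-mono 1≤X ⟩
    ∑ (λ a → y (X (ι a) w))                ≡⟨ ∑-nodes-0 (λ z → y (X z w)) (Feasible.X-diag F w) (λ _ → refl) ⟨
    ∑ (λ z → y (X z w))                    ≤⟨ Feasible.depth F w ⟩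
    y (D w)                                ∎
    where open ≤-Reasoning

  bottom-vertex : ∀ {x} → IsVertex (STT U) x → IsVertex (STT U′) (bottom x)
  bottom-vertex {x} (Sx , extreme) = feasible⇒STT (bottom-feasible x (STT⇒feasible Sx)) , unique
    where
    unique : ∀ y z t → 0ℚ < t → t < 1ℚ → STT U′ y → STT U′ z →
      (∀ c → bottom x c ≡ t * y c + (1ℚ - t) * z c) → ∀ c → y c ≡ z c
    unique y z t 0<t t<1 Sy Sz eq = equal
      where
      Fy : Feasible U′ y
      Fy = STT⇒feasible Sy
      Fz : Feasible U′ z
      Fz = STT⇒feasible Sz
      module Y = Feasible Fy
      module Z′ = Feasible Fz
      -- Where `bottom x` sits on a lower bound valid at both ends of the segment, both ends sit on
      -- it too.
      tight : ∀ c {l} → bottom x c ≡ l → l ≤ y c → l ≤ z c → y c ≡ l × z c ≡ l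
      tight c bc≡l l≤y l≤z = convex-lower 0<t t<1 l≤y l≤z (trans (sym bc≡l) (eq c))
      same : ∀ c {l} → y c ≡ l × z c ≡ l → y c ≡ z c
      same c (y≡l , z≡l) = trans y≡l (sym z≡l)
      Xw : ∀ v → y (X w v) ≡ 0ℚ × z (X w v) ≡ 0ℚ
      Xw v = tight (X w v) (bottom-Xw x v) (Y.X≥0 w v) (Z′.X≥0 w v)
      Zw : ∀ u v → y (Z w u v) ≡ 0ℚ × z (Z w u v) ≡ 0ℚ
      Zw u v = tight (Z w u v) (bottom-Zw x u v) (Y.Z≥0 w u v) (Z′.Z≥0 w u v)
      Z·w : ∀ k v → y (Z k w v) ≡ 0ℚ × z (Z k w v) ≡ 0ℚ
      Z·w k v = tight (Z k w v) (bottom-Z·w x k v) (Y.Z≥0 k w v) (Z′.Z≥0 k w v)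
      Z··w : ∀ k v → y (Z k v w) ≡ 0ℚ × z (Z k v w) ≡ 0ℚ
      Z··w k v = tight (Z k v w) (bottom-Z··w x k v) (Y.Z≥0 k v w) (Z′.Z≥0 k v w)
      -- This bound is not an LP constraint: it appears only after the zeros above have emptied the
      -- rest of the covering constraint. The bound on `D w` rests on it in turn.
      1≤y : ∀ a → 1ℚ ≤ y (X (ι a) w)
      1≤y = covers-w Fy (proj₁ ∘ Xw) (λ k v → proj₁ (Z··w k v))
      1≤z : ∀ a → 1ℚ ≤ z (X (ι a) w)
      1≤z = covers-w Fz (proj₂ ∘ Xw) (λ k v → proj₂ (Z··w k v))
      contract-y : ∀ c → contract y c ≡ y (ι-coord c)
      contract-y = contract-ι y (λ a → proj₁ (Xw (ι a))) (λ a b → proj₁ (Zw (ι a) (ι b)))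
      contract-z : ∀ c → contract z c ≡ z (ι-coord c)
      contract-z = contract-ι z (λ a → proj₂ (Xw (ι a))) (λ a b → proj₂ (Zw (ι a) (ι b)))
      old-equal : ∀ c → y (ι-coord c) ≡ z (ι-coord c)
      old-equal c = trans (sym (contract-y c)) (trans
        (extreme (contract y) (contract z) t 0<t t<1
          (feasible⇒STT (contract-feasible y Fy)) (feasible⇒STT (contract-feasible z Fz))
          (λ c → trans (sym (bottom-ι x c)) (trans (eq (ι-coord c))
            (sym (cong₂ (λ p q → t * p + (1ℚ - t) * q) (contract-y c) (contract-z c))))) c)
        (contract-z c))
      equal : ∀ c → y c ≡ z c
      equal (D v) = by-node (λ v → y (D v) ≡ z (D v))
        (same (D w) (tight (D w) (bottom-Dw x) (depth-w Fy 1≤y) (depth-w Fz 1≤z)))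
        (old-equal ∘ D) v
      equal (X u v) = by-node (λ u → ∀ v → y (X u v) ≡ z (X u v))
        (λ v → same (X w v) (Xw v))
        (λ a → by-node (λ v → y (X (ι a) v) ≡ z (X (ι a) v))
          (same (X (ι a) w) (tight (X (ι a) w) (bottom-Xιw x a) (1≤y a) (1≤z a)))
          (old-equal ∘ X a)) u v
      equal (Z k u v) = by-node (λ k → ∀ u v → y (Z k u v) ≡ z (Z k u v))
        (λ u v → same (Z w u v) (Zw u v))
        (λ c → by-node (λ u → ∀ v → y (Z (ι c) u v) ≡ z (Z (ι c) u v))
          (λ v → same (Z (ι c) w v) (Z·w (ι c) v))
          (λ a → by-node (λ v → y (Z (ι c) (ι a) v) ≡ z (Z (ι c) (ι a) v))
            (same (Z (ι c) (ι a) w) (Z··w (ι c) (ι a)))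
            (old-equal ∘ Z c a))) k u v

  extend-vertex : HasNonIntVertex (STT U) → HasNonIntVertex (STT U′)
  extend-vertex (x , vertex , c , nonint) =
    bottom x , bottom-vertex vertex , ι-coord c , subst (¬_ ∘ IsInt) (sym (bottom-ι x c)) nonint

  -- Vertices of the depth projection

  module _ {d} (extreme : IsVertex (STT-D U) d) where

    x₀ : Coord (suc n) → ℚ
    x₀ = bottom (proj₁ (proj₁ extreme))

    STT-x₀ : STT U′ x₀
    STT-x₀ = feasible⇒STT (bottom-feasible _ (STT⇒feasible (proj₁ (proj₂ (proj₁ extreme)))))

    x₀-D : ∀ a → x₀ (D (ι a)) ≡ d a
    x₀-D a = trans (bottom-ι _ (D a)) (proj₂ (proj₂ (proj₁ extreme)) a)

    LeastDepth : (Coord (suc n) → ℚ) → Set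
    LeastDepth x = STT U′ x × (∀ a → x (D (ι a)) ≡ d a) ×
      (∀ y → STT U′ y → (∀ a → y (D (ι a)) ≡ d a) → x (D w) ≤ y (D w))

    least-depth : ∃ LeastDepth
    -- All `X` and `Z` coordinates are eliminated, the old depths stay fixed at those of `x₀`, and
    -- nonnegativity of depths bounds `D w` from below.
    least-depth = from-minimiser (minimise (constraints P) (nonDepth (suc n)) (D w) x₀ (D∉nonDepth w)
      (complete P x₀ STT-x₀) (λ y sat → Feasible.D≥0 (STT⇒feasible {U = U′} {y} (sound P y sat)) w))
      where
      P : Polyhedral (STT U′)
      P = STT-polyhedral U′
      Dι∉ : ∀ a → D (ι a) ∉ D w ∷ nonDepth (suc n)
      -- The local function reads off an index to make `D` injective; its values on `X` and `Z` are
      -- arbitrary.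
      Dι∉ a (here eq)  = ι≢w (cong (λ { (D i) → i ; (X i _) → i ; (Z i _ _) → i }) eq)
      Dι∉ a (there D∈) = D∉nonDepth (ι a) D∈
      agree : ∀ y → (∀ a → y (D (ι a)) ≡ d a) → AgreeOff (D w ∷ nonDepth (suc n)) x₀ y
      agree y yD {c} c∉ = on-depth (∉nonDepth⇒D (c∉ ∘ there))
        where
        on-depth : (∃ λ i → c ≡ D i) → x₀ c ≡ y c
        on-depth (i , refl) = [ (λ { refl → contradiction (here refl) c∉ }) ,
          (λ { (a , refl) → trans (x₀-D a) (sym (yD a)) }) ]′ (cover i)
      from-minimiser : ∃ (Minimiser (constraints P) (nonDepth (suc n)) (D w) x₀) → ∃ LeastDepth
      from-minimiser (x , sat , agrees , least) = x , sound P x sat ,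
        (λ a → trans (sym (agrees (Dι∉ a))) (x₀-D a)) ,
        λ y Sy yD → least y (complete P y Sy) (agree y yD)

    least-vertex : ∀ {x} → LeastDepth x → IsVertex (STT-D U′) (λ v → x (D v))
    least-vertex {x} (Sx , xD , least) = (x , Sx , λ _ → refl) , unique
      where
      unique : ∀ y z t → 0ℚ < t → t < 1ℚ → STT-D U′ y → STT-D U′ z →
        (∀ v → x (D v) ≡ t * y v + (1ℚ - t) * z v) → ∀ v → y v ≡ z v
      unique y z t 0<t t<1 (y̅ , Sy , y̅D) (z̅ , Sz , z̅D) eq = by-node (λ v → y v ≡ z v) w-equal old-equal
        where
        contracted : ∀ {v} x̅ → STT U′ x̅ → (∀ i → x̅ (D i) ≡ v i) → STT-D U (v ∘ ι)
        contracted x̅ S x̅D = contract x̅ , feasible⇒STT (contract-feasible x̅ (STT⇒feasible S)) , λ a → x̅D (ι a)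
        d-eq : ∀ a → d a ≡ t * y (ι a) + (1ℚ - t) * z (ι a)
        d-eq a = trans (sym (xD a)) (eq (ι a))
        old-equal : ∀ a → y (ι a) ≡ z (ι a)
        old-equal = proj₂ extreme (y ∘ ι) (z ∘ ι) t 0<t t<1 (contracted y̅ Sy y̅D) (contracted z̅ Sz z̅D) d-eq
        -- Both ends agree on the old nodes, so their average `d` is that common value. Hence both
        -- compete in the minimisation of `D w`.
        y≡d : ∀ a → y (ι a) ≡ d a
        y≡d a = sym (trans (d-eq a) (trans (cong (λ q → t * y (ι a) + (1ℚ - t) * q) (sym (old-equal a)))
                  (convex-idem t (y (ι a)))))
        w-tight : y w ≡ x (D w) × z w ≡ x (D w)
        w-tight = convex-lower 0<t t<1
          (subst (x (D w) ≤_) (y̅D w) (least y̅ Sy (λ a → trans (y̅D (ι a)) (y≡d a))))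
          (subst (x (D w) ≤_) (z̅D w) (least z̅ Sz (λ a → trans (z̅D (ι a)) (trans (sym (old-equal a)) (y≡d a)))))
          (eq w)
        w-equal : y w ≡ z w
        w-equal = trans (proj₁ w-tight) (sym (proj₂ w-tight))

  extend-depth-vertex : HasNonIntVertex (STT-D U) → HasNonIntVertex (STT-D U′)
  extend-depth-vertex (d , extreme , a , nonint) = finish (least-depth extreme)
    where
    finish : ∃ (LeastDepth extreme) → HasNonIntVertex (STT-D U′)
    finish (x , least@(_ , xD , _)) =
      (λ v → x (D v)) , least-vertex extreme {x} least , ι a , subst (¬_ ∘ IsInt) (sym (xD a)) nonint

-- Induction along the sequence of single extensions

theorem3p12 : ∀ {m n : ℕ} (U : Tree m) (U' : Tree n) → Extends U U' →
    (HasNonIntVertex (STT U) → HasNonIntVertex (STT U')) ×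
    (HasNonIntVertex (STT-D U) → HasNonIntVertex (STT-D U'))
theorem3p12 U .U done = (λ v → v) , (λ v → v)
theorem3p12 U U' (more {G = G} steps last) =
  extend-vertex ∘ proj₁ (theorem3p12 U G steps) , extend-depth-vertex ∘ proj₂ (theorem3p12 U G steps)
  where open ExtendAndContract (extension last)
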